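{- Let $c > 2/9$ be a constant and let $U$ be a vertex subset of size $\lfloor cn^2\rfloor$ in the graph $J(n,3,\{1\})$. Then $U$ contains (induces) at least $$\left(\frac{9c^2}{2} - c + o(1)\right)n^3$$ edges of $J(n,3,\{1\})$, where $o(1)$ denotes a quantity depending only on $c$ and $n$ (not on the choice of $U$) that tends to $0$ as $n\to\infty$ with $c$ fixed.
   Context: The graph $J(n,3,\{1\})$ is the simple graph whose vertex set is the collection $\binom{[n]}{3}$ of all 3-element subsets of $[n]=\{1,\ldots,n\}$, in which two vertices are adjacent if and only if the corresponding 3-sets intersect in exactly one element. The edges contained in (induced by) a vertex subset $U$ are the edges of the graph with both endpoints in $U$. -}

module Defs where

open import Data.Fin.Subset using (Subset; ∣_∣; _∩_)
open import Data.Fin.Subset.Properties using (∩-comm; ∩-idem)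
open import Data.Integer.Base using (+_)
open import Data.List.Base using (List; []; _∷_; _++_; map; length; filter)
open import Data.List.Relation.Unary.Unique.Propositional using (Unique)
open import Data.Nat.Base as ℕ using (ℕ; suc; _⊔_)
import Data.Nat.Properties as ℕ
open import Data.Product.Base using (Σ; _×_; _,_; proj₁; proj₂; ∃-syntax)
open import Data.Rational.Base as ℚ using (ℚ; 0ℚ; 1ℚ; ½)
import Data.Rational.Properties as ℚ
open import Data.Rational.Solver using (module +-*-Solver)
open import Relation.Binary.PropositionalEquality
  using (_≡_; refl; sym; trans; cong; subst)
open import Relation.Nullary using (¬_; Dec)


IsCauchy : (ℕ → ℚ) → Set
IsCauchy x = ∀ ε → 0ℚ ℚ.< ε →
  ∃[ N ] (∀ i j → N ℕ.≤ i → N ℕ.≤ j → ℚ.∣ x i ℚ.- x j ∣ ℚ.< ε)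

-- Since Σ is strong, `cauchy` carries a modulus of convergence.  Distinct
-- sequences may name the same real; all notions below that mention reals
-- depend only on their values.

record ℝ : Set where
  constructor mkℝ
  field
    seq    : ℕ → ℚ
    cauchy : IsCauchy seq

open ℝ public

private
  half+half : ∀ p → ½ ℚ.* p ℚ.+ ½ ℚ.* p ≡ p
  half+half p = trans (sym (ℚ.*-distribʳ-+ p ½ ½)) (ℚ.*-identityˡ p)

  half-pos : ∀ {p} → 0ℚ ℚ.< p → 0ℚ ℚ.< ½ ℚ.* p
  half-pos {p} 0<p =
    subst (ℚ._< ½ ℚ.* p) (ℚ.*-zeroʳ ½) (ℚ.*-monoʳ-<-pos ½ 0<p)

  const-cauchy : ∀ q → IsCauchy (λ _ → q)
  const-cauchy q ε 0<ε = 0 , λ _ _ _ _ →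
    subst (ℚ._< ε) (sym (cong ℚ.∣_∣ (ℚ.+-inverseʳ q))) 0<ε

  +-cauchy : ∀ {x y} → IsCauchy x → IsCauchy y → IsCauchy (λ k → x k ℚ.+ y k)
  +-cauchy {x} {y} cx cy ε 0<ε
    with cx (½ ℚ.* ε) (half-pos 0<ε) | cy (½ ℚ.* ε) (half-pos 0<ε)
  ... | M , p | N , q = M ⊔ N , λ i j ≤i ≤j → begin-strict
    ℚ.∣ (x i ℚ.+ y i) ℚ.- (x j ℚ.+ y j) ∣
      ≡⟨ cong ℚ.∣_∣ (regroup (x i) (y i) (x j) (y j)) ⟩
    ℚ.∣ (x i ℚ.- x j) ℚ.+ (y i ℚ.- y j) ∣
      ≤⟨ ℚ.∣p+q∣≤∣p∣+∣q∣ (x i ℚ.- x j) (y i ℚ.- y j) ⟩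
    ℚ.∣ x i ℚ.- x j ∣ ℚ.+ ℚ.∣ y i ℚ.- y j ∣
      <⟨ ℚ.+-mono-< (p i j (ℕ.m⊔n≤o⇒m≤o M N ≤i) (ℕ.m⊔n≤o⇒m≤o M N ≤j))
                    (q i j (ℕ.m⊔n≤o⇒n≤o M N ≤i) (ℕ.m⊔n≤o⇒n≤o M N ≤j)) ⟩
    ½ ℚ.* ε ℚ.+ ½ ℚ.* ε
      ≡⟨ half+half ε ⟩
    ε ∎
    where
    open ℚ.≤-Reasoning
    regroup : ∀ a b c d →
      (a ℚ.+ b) ℚ.- (c ℚ.+ d) ≡ (a ℚ.- c) ℚ.+ (b ℚ.- d)
    regroup = solve 4 (λ a b c d →
      ((a :+ b) :- (c :+ d)) := ((a :- c) :+ (b :- d))) refl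
      where open +-*-Solver

  neg-cauchy : ∀ {x} → IsCauchy x → IsCauchy (λ k → ℚ.- x k)
  neg-cauchy {x} cx ε 0<ε with cx ε 0<ε
  ... | N , p = N , λ i j ≤i ≤j →
    subst (ℚ._< ε)
      (trans (sym (ℚ.∣-p∣≡∣p∣ (x i ℚ.- x j)))
             (cong ℚ.∣_∣ (ℚ.neg-distrib-+ (x i) (ℚ.- x j))))
      (p i j ≤i ≤j)

  eventually-bounded : ∀ {x} → IsCauchy x →
    ∃[ B ] 0ℚ ℚ.< B × ∃[ N ] (∀ k → N ℕ.≤ k → ℚ.∣ x k ∣ ℚ.≤ B)
  eventually-bounded {x} cx with cx 1ℚ (ℚ.positive⁻¹ 1ℚ)
  ... | N , p = 1ℚ ℚ.+ ℚ.∣ x N ∣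
              , ℚ.+-mono-<-≤ (ℚ.positive⁻¹ 1ℚ) (ℚ.0≤∣p∣ (x N))
              , N , λ k ≤k → begin
    ℚ.∣ x k ∣
      ≡⟨ cong ℚ.∣_∣ (split (x k) (x N)) ⟩
    ℚ.∣ (x k ℚ.- x N) ℚ.+ x N ∣
      ≤⟨ ℚ.∣p+q∣≤∣p∣+∣q∣ (x k ℚ.- x N) (x N) ⟩
    ℚ.∣ x k ℚ.- x N ∣ ℚ.+ ℚ.∣ x N ∣
      ≤⟨ ℚ.+-monoˡ-≤ ℚ.∣ x N ∣ (ℚ.<⇒≤ (p k N ≤k ℕ.≤-refl)) ⟩
    1ℚ ℚ.+ ℚ.∣ x N ∣ ∎
    where
    open ℚ.≤-Reasoning
    split : ∀ a b → a ≡ (a ℚ.- b) ℚ.+ b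
    split = solve 2 (λ a b → a := ((a :- b) :+ b)) refl
      where open +-*-Solver

  quotient : ∀ {B ε} → 0ℚ ℚ.< B → 0ℚ ℚ.< ε → ∃[ δ ] 0ℚ ℚ.< δ × B ℚ.* δ ≡ ε
  quotient {B} {ε} 0<B 0<ε = B⁻¹ ℚ.* ε
    , subst (ℚ._< B⁻¹ ℚ.* ε) (ℚ.*-zeroʳ B⁻¹) (ℚ.*-monoʳ-<-pos B⁻¹ 0<ε)
    , trans (sym (ℚ.*-assoc B B⁻¹ ε))
            (trans (cong (ℚ._* ε) (ℚ.*-inverseʳ B)) (ℚ.*-identityˡ ε))
    where
    instance
      B-pos : ℚ.Positive B
      B-pos = ℚ.positive 0<B
      B-nonZero : ℚ.NonZero B
      B-nonZero = ℚ.pos⇒nonZero B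
    B⁻¹ : ℚ
    B⁻¹ = ℚ.1/ B
    instance
      B⁻¹-pos : ℚ.Positive B⁻¹
      B⁻¹-pos = ℚ.1/pos⇒pos B

  bound-* : ∀ {B δ η} a b → 0ℚ ℚ.< B → B ℚ.* δ ≡ η →
    ℚ.∣ a ∣ ℚ.≤ B → ℚ.∣ b ∣ ℚ.< δ → ℚ.∣ a ℚ.* b ∣ ℚ.< η
  bound-* {B} {δ} {η} a b 0<B Bδ≡η a≤B b<δ = begin-strict
    ℚ.∣ a ℚ.* b ∣          ≡⟨ ℚ.∣p*q∣≡∣p∣*∣q∣ a b ⟩
    ℚ.∣ a ∣ ℚ.* ℚ.∣ b ∣    ≤⟨ ℚ.*-monoʳ-≤-nonNeg ℚ.∣ b ∣ {{ℚ.∣-∣-nonNeg b}} a≤B ⟩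
    B ℚ.* ℚ.∣ b ∣          <⟨ ℚ.*-monoʳ-<-pos B {{ℚ.positive 0<B}} b<δ ⟩
    B ℚ.* δ                ≡⟨ Bδ≡η ⟩
    η                      ∎
    where open ℚ.≤-Reasoning

  *-estimate : ∀ {A B α β ε} a b c d → 0ℚ ℚ.< A → 0ℚ ℚ.< B →
    A ℚ.* α ≡ ½ ℚ.* ε → B ℚ.* β ≡ ½ ℚ.* ε →
    ℚ.∣ a ∣ ℚ.≤ A → ℚ.∣ d ∣ ℚ.≤ B →
    ℚ.∣ b ℚ.- d ∣ ℚ.< α → ℚ.∣ a ℚ.- c ∣ ℚ.< β →
    ℚ.∣ a ℚ.* b ℚ.- c ℚ.* d ∣ ℚ.< ε
  *-estimate {ε = ε} a b c d 0<A 0<B Aα≡ Bβ≡ a≤A d≤B b-d<α a-c<β = begin-strict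
    ℚ.∣ a ℚ.* b ℚ.- c ℚ.* d ∣
      ≡⟨ cong ℚ.∣_∣ (regroup a b c d) ⟩
    ℚ.∣ a ℚ.* (b ℚ.- d) ℚ.+ d ℚ.* (a ℚ.- c) ∣
      ≤⟨ ℚ.∣p+q∣≤∣p∣+∣q∣ (a ℚ.* (b ℚ.- d)) (d ℚ.* (a ℚ.- c)) ⟩
    ℚ.∣ a ℚ.* (b ℚ.- d) ∣ ℚ.+ ℚ.∣ d ℚ.* (a ℚ.- c) ∣
      <⟨ ℚ.+-mono-< (bound-* a (b ℚ.- d) 0<A Aα≡ a≤A b-d<α)
                    (bound-* d (a ℚ.- c) 0<B Bβ≡ d≤B a-c<β) ⟩
    ½ ℚ.* ε ℚ.+ ½ ℚ.* ε
      ≡⟨ half+half ε ⟩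
    ε ∎
    where
    open ℚ.≤-Reasoning
    regroup : ∀ a b c d →
      a ℚ.* b ℚ.- c ℚ.* d ≡ a ℚ.* (b ℚ.- d) ℚ.+ d ℚ.* (a ℚ.- c)
    regroup = solve 4 (λ a b c d →
      (a :* b :- c :* d) := (a :* (b :- d) :+ d :* (a :- c))) refl
      where open +-*-Solver

  *-cauchy : ∀ {x y} → IsCauchy x → IsCauchy y → IsCauchy (λ k → x k ℚ.* y k)
  *-cauchy {x} {y} cx cy ε 0<ε =
    let A , 0<A , K , x≤A = eventually-bounded cx
        B , 0<B , L , y≤B = eventually-bounded cy
        α , 0<α , Aα≡ = quotient 0<A (half-pos 0<ε)
        β , 0<β , Bβ≡ = quotient 0<B (half-pos 0<ε)
        M , x-x<β = cx β 0<β
        N , y-y<α = cy α 0<α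
    in (K ⊔ L) ⊔ (M ⊔ N) , λ i j ≤i ≤j →
    let KL≤i = ℕ.m⊔n≤o⇒m≤o (K ⊔ L) (M ⊔ N) ≤i
        MN≤i = ℕ.m⊔n≤o⇒n≤o (K ⊔ L) (M ⊔ N) ≤i
        KL≤j = ℕ.m⊔n≤o⇒m≤o (K ⊔ L) (M ⊔ N) ≤j
        MN≤j = ℕ.m⊔n≤o⇒n≤o (K ⊔ L) (M ⊔ N) ≤j
    in *-estimate (x i) (y i) (x j) (y j) 0<A 0<B Aα≡ Bβ≡
         (x≤A i (ℕ.m⊔n≤o⇒m≤o K L KL≤i))
         (y≤B j (ℕ.m⊔n≤o⇒n≤o K L KL≤j))
         (y-y<α i j (ℕ.m⊔n≤o⇒n≤o M N MN≤i) (ℕ.m⊔n≤o⇒n≤o M N MN≤j))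
         (x-x<β i j (ℕ.m⊔n≤o⇒m≤o M N MN≤i) (ℕ.m⊔n≤o⇒m≤o M N MN≤j))

infixl 7 _*_
infixl 6 _+_ _-_
infix  8 -_
infix  4 _<_ _≤_

fromℚ : ℚ → ℝ
fromℚ q = mkℝ (λ _ → q) (const-cauchy q)

fromℕ : ℕ → ℝ
fromℕ n = fromℚ (+ n ℚ./ 1)

0ℝ : ℝ
0ℝ = fromℚ 0ℚ

_+_ : ℝ → ℝ → ℝ
x + y = mkℝ (λ k → seq x k ℚ.+ seq y k) (+-cauchy {seq x} {seq y} (cauchy x) (cauchy y))

-_ : ℝ → ℝ
- x = mkℝ (λ k → ℚ.- seq x k) (neg-cauchy {seq x} (cauchy x))

_-_ : ℝ → ℝ → ℝ
x - y = x + (- y)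

_*_ : ℝ → ℝ → ℝ
x * y = mkℝ (λ k → seq x k ℚ.* seq y k) (*-cauchy {seq x} {seq y} (cauchy x) (cauchy y))

_<_ : ℝ → ℝ → Set
x < y = ∃[ δ ] 0ℚ ℚ.< δ ×
  ∃[ N ] (∀ k → N ℕ.≤ k → seq x k ℚ.+ δ ℚ.≤ seq y k)

-- Comparing terms without the slack ε would make the order depend on the
-- choice of representing sequences.

_≤_ : ℝ → ℝ → Set
x ≤ y = ∀ ε → 0ℚ ℚ.< ε →
  ∃[ N ] (∀ k → N ℕ.≤ k → seq x k ℚ.≤ seq y k ℚ.+ ε)

-- The floor is a relation because it is not computable on ℝ.

_IsFloorOf_ : ℕ → ℝ → Set
m IsFloorOf x = fromℕ m ≤ x × x < fromℕ (suc m)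

TendsToZero : (ℕ → ℝ) → Set
TendsToZero a = ∀ (ε : ℝ) → 0ℝ < ε →
  ∃[ N ] (∀ n → N ℕ.≤ n → - ε < a n × a n < ε)


record SimpleGraph : Set₁ where
  field
    Vertex : Set
    Adj    : Vertex → Vertex → Set
    adj?   : ∀ u v → Dec (Adj u v)
    symm   : ∀ {u v} → Adj u v → Adj v u
    irrefl : ∀ {v} → ¬ Adj v v

record VertexSubset (G : SimpleGraph) : Set where
  field
    elements : List (SimpleGraph.Vertex G)
    unique   : Unique elements

unorderedPairs : {A : Set} → List A → List (A × A)
unorderedPairs []       = []
unorderedPairs (x ∷ xs) = map (x ,_) xs ++ unorderedPairs xs

module _ {G : SimpleGraph} (U : VertexSubset G) where
  open SimpleGraph G
  open VertexSubset U

  size : ℕ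
  size = length elements

  inducedEdges : List (Vertex × Vertex)
  inducedEdges = filter (λ (u , v) → adj? u v) (unorderedPairs elements)

  numInducedEdges : ℕ
  numInducedEdges = length inducedEdges

-- The ground set [n] is modelled by Fin n.

J[_,3,⟨1⟩] : ℕ → SimpleGraph
J[ n ,3,⟨1⟩] = record
  { Vertex = Σ (Subset n) (λ s → ∣ s ∣ ≡ 3)
  ; Adj    = λ u v → ∣ proj₁ u ∩ proj₁ v ∣ ≡ 1
  ; adj?   = λ u v → ∣ proj₁ u ∩ proj₁ v ∣ ℕ.≟ 1
  ; symm   = λ {u} {v} e → trans (cong ∣_∣ (∩-comm (proj₁ v) (proj₁ u))) e
  ; irrefl = λ {v} e → 3≢1 (trans (sym (proj₂ v))
                              (trans (sym (cong ∣_∣ (∩-idem (proj₁ v)))) e))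
  }
  where
  3≢1 : ¬ (3 ≡ 1)
  3≢1 ()

{-# OPTIONS --safe #-}
-- Let d(x) and d(x,y) count the triples of U through x and through {x,y}, and let S = Σ d(x)².
-- Every i ∈ ℕ satisfies 2i ≤ [i = 1] + i²; summed over the sizes i of the intersections of all
-- ordered pairs of triples this reads S ≤ 2 e(U) + 2 Σ_{T ∈ U} w(T), where w(T) is the sum of
-- d over the three pairs in T.  Each d(x,y) is at most n.  Only the largest of the three
-- codegrees in w(T) is charged n: by AM-GM the other two together are at most l plus 1/l times
-- a sum of products d(x,y) d(x,z) of two codegrees in T, and over all T ∈ U such products add
-- up to O(S) because Σ_y d(x,y) = 3 d(x).  With l of order √n,
--   (1 − O(1/√n)) S ≤ 2 e(U) + 2 |U| n + O(|U| √n),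
-- and S ≥ 9 |U|² / n by Cauchy–Schwarz.
module Submission where

open import Defs hiding (_+_; _*_; -_; _-_; _<_; _≤_)
open import Data.Fin.Base using (Fin; zero; suc)
import Data.Fin.Properties as Fin
open import Data.Fin.Subset using (Subset; inside; outside; ∣_∣; _∩_; ⊥) renaming (_∈_ to _∈ₛ_)
open import Data.Fin.Subset.Properties using (∩-comm; ∩-idem)
open import Data.Bool.Base using (if_then_else_)
open import Data.Integer.Base as ℤ using (-[1+_])
import Data.Integer.Properties as ℤ
import Data.Integer.Tactic.RingSolver as ℤ-Solver
open import Data.List.Base using (List; []; _∷_; _++_; map; length; filter; allFin; cartesianProduct)
open import Data.List.Membership.Propositional using (_∈_)
open import Data.List.Membership.Propositional.Properties
  using (∈-∃++; ∈-++⁻; ∈-++⁺ˡ; ∈-++⁺ʳ; ∈-map⁻; ∈-map⁺; ∈-allFin; ∈-cartesianProduct⁺)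
open import Data.List.Properties using (map-∘; map-++; map-tabulate; length-map; length-tabulate)
open import Data.List.Relation.Unary.All as All using ([]; _∷_)
open import Data.List.Relation.Unary.AllPairs using ([]; _∷_)
open import Data.List.Relation.Unary.Any using (here; there)
open import Data.List.Relation.Unary.Unique.Propositional using (Unique)
import Data.List.Relation.Unary.Unique.Propositional.Properties as Unique
open import Data.Nat.Base as ℕ using (ℕ; zero; suc; _^_; _⊔_; z≤n; s≤s)
open import Data.Nat.ListAction using (sum)
open import Data.Nat.ListAction.Properties using (sum-++)
import Data.Nat.Properties as ℕ
import Data.Nat.Tactic.RingSolver as ℕ-Solver
open import Data.Product.Base using (Σ; _×_; _,_; proj₁; proj₂; ∃-syntax; uncurry)
open import Data.Rational.Base as ℚ using (ℚ; mkℚ; 0ℚ; 1ℚ; ½; _/_)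
import Data.Rational.Properties as ℚ
open import Data.Rational.Solver using (module +-*-Solver)
open import Data.Rational.Unnormalised.Base as ℚᵘ using (mkℚᵘ)
import Data.Rational.Unnormalised.Properties as ℚᵘ
open import Data.Sum.Base using (_⊎_; inj₁; inj₂)
open import Data.Vec.Base using ([]; _∷_; lookup; _[_]≔_; here; there)
open import Data.Vec.Properties using (lookup⇒[]=; []≔-minimal)
open import Function.Base using (_∘_; id)
open import Relation.Binary.PropositionalEquality
  using (_≡_; _≢_; refl; sym; trans; cong; cong₂; subst; subst₂; module ≡-Reasoning)
open import Relation.Nullary using (¬_; yes; no; contradiction)
open import Relation.Unary using (Decidable)

module Counting where
  open import Data.Nat.Base using (_+_; _*_; _≤_; _<_)
  open ℕ-Solver using (solve-∀)

  private
    variable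
      A B : Set
      n k : ℕ

  -- Sums over finite lists.

  ∑ : List A → (A → ℕ) → ℕ
  ∑ xs f = sum (map f xs)

  infix 5 ∑
  syntax ∑ xs (λ x → e) = ∑[ x ∈ xs ] e

  ∑-cong : ∀ (xs : List A) {f g : A → ℕ} → (∀ x → f x ≡ g x) → ∑ xs f ≡ ∑ xs g
  ∑-cong []       f≡g = refl
  ∑-cong (x ∷ xs) f≡g = cong₂ _+_ (f≡g x) (∑-cong xs f≡g)

  ∑-mono : ∀ (xs : List A) {f g : A → ℕ} → (∀ x → f x ≤ g x) → ∑ xs f ≤ ∑ xs g
  ∑-mono []       f≤g = z≤n
  ∑-mono (x ∷ xs) f≤g = ℕ.+-mono-≤ (f≤g x) (∑-mono xs f≤g)

  ∑-distrib-+ : ∀ (xs : List A) (f g : A → ℕ) →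
    ∑[ x ∈ xs ] (f x + g x) ≡ ∑ xs f + ∑ xs g
  ∑-distrib-+ []       f g = refl
  ∑-distrib-+ (x ∷ xs) f g =
    trans (cong (f x + g x +_) (∑-distrib-+ xs f g)) (shuffle (f x) (g x) _ _)
    where
    shuffle : ∀ a b c d → a + b + (c + d) ≡ a + c + (b + d)
    shuffle = solve-∀

  *-distribˡ-∑ : ∀ k (xs : List A) (f : A → ℕ) → ∑[ x ∈ xs ] (k * f x) ≡ k * ∑ xs f
  *-distribˡ-∑ k []       f = sym (ℕ.*-zeroʳ k)
  *-distribˡ-∑ k (x ∷ xs) f =
    trans (cong (k * f x +_) (*-distribˡ-∑ k xs f)) (sym (ℕ.*-distribˡ-+ k (f x) _))

  *-distribʳ-∑ : ∀ k (xs : List A) (f : A → ℕ) → ∑[ x ∈ xs ] (f x * k) ≡ ∑ xs f * k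
  *-distribʳ-∑ k []       f = refl
  *-distribʳ-∑ k (x ∷ xs) f =
    trans (cong (f x * k +_) (*-distribʳ-∑ k xs f)) (sym (ℕ.*-distribʳ-+ k (f x) _))

  ∑-const : ∀ (xs : List A) k → ∑[ _ ∈ xs ] k ≡ length xs * k
  ∑-const []       k = refl
  ∑-const (x ∷ xs) k = cong (k +_) (∑-const xs k)

  ∑-comm : ∀ (xs : List A) (ys : List B) (f : A → B → ℕ) →
    (∑[ x ∈ xs ] ∑[ y ∈ ys ] f x y) ≡ (∑[ y ∈ ys ] ∑[ x ∈ xs ] f x y)
  ∑-comm []       ys f = sym (trans (∑-const ys 0) (ℕ.*-zeroʳ (length ys)))
  ∑-comm (x ∷ xs) ys f =
    trans (cong (∑ ys (f x) +_) (∑-comm xs ys f))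
          (sym (∑-distrib-+ ys (f x) (λ y → ∑[ x ∈ xs ] f x y)))

  ∑-*-∑ : ∀ (xs : List A) (ys : List B) (f : A → ℕ) (g : B → ℕ) →
    (∑[ x ∈ xs ] ∑[ y ∈ ys ] (f x * g y)) ≡ ∑ xs f * ∑ ys g
  ∑-*-∑ xs ys f g =
    trans (∑-cong xs (λ x → *-distribˡ-∑ (f x) ys g)) (*-distribʳ-∑ (∑ ys g) xs f)

  ∑-++ : ∀ (xs ys : List A) (f : A → ℕ) → ∑ (xs ++ ys) f ≡ ∑ xs f + ∑ ys f
  ∑-++ xs ys f = trans (cong sum (map-++ f xs ys)) (sum-++ (map f xs) (map f ys))

  ∑-map : ∀ (h : A → B) (xs : List A) (f : B → ℕ) → ∑ (map h xs) f ≡ ∑ xs (f ∘ h)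
  ∑-map h xs f = cong sum (sym (map-∘ xs))

  ∑-cartesianProduct : ∀ (xs : List A) (ys : List B) (f : A × B → ℕ) →
    ∑ (cartesianProduct xs ys) f ≡ (∑[ x ∈ xs ] ∑[ y ∈ ys ] f (x , y))
  ∑-cartesianProduct []       ys f = refl
  ∑-cartesianProduct (x ∷ xs) ys f =
    trans (∑-++ (map (x ,_) ys) (cartesianProduct xs ys) f)
          (cong₂ _+_ (∑-map (x ,_) ys f) (∑-cartesianProduct xs ys f))

  ∑-allFin-suc : ∀ n (f : Fin (suc n) → ℕ) →
    ∑ (allFin (suc n)) f ≡ f zero + ∑ (allFin n) (f ∘ suc)
  ∑-allFin-suc n f = cong (f zero +_)
    (trans (cong (λ xs → ∑ xs f) (sym (map-tabulate (λ x → x) suc))) (∑-map suc (allFin n) f))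

  -- Since `xs` has no repetitions, each `x` found in `ys` can be charged to an occurrence of its
  -- own. Deleting that occurrence keeps the hypothesis true for the rest of `xs`, because `x` does
  -- not recur there.
  ∑-≤-support : ∀ {xs ys : List A} {f : A → ℕ} → Unique xs →
    (∀ {x} → x ∈ xs → f x ≡ 0 ⊎ x ∈ ys) → ∑ xs f ≤ ∑ ys f
  ∑-≤-support []                         _ = z≤n
  ∑-≤-support {xs = x ∷ xs} {ys} {f} (x∉xs ∷ xs!) cover with cover (here refl)
  ... | inj₁ fx≡0 =
    subst (λ k → k + ∑ xs f ≤ ∑ ys f) (sym fx≡0) (∑-≤-support xs! (cover ∘ there))
  ... | inj₂ x∈ys with as , bs , refl ← ∈-∃++ x∈ys = begin
    f x + ∑ xs f               ≤⟨ ℕ.+-monoʳ-≤ (f x) (∑-≤-support xs! cover′) ⟩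
    f x + ∑ (as ++ bs) f       ≡⟨ cong (f x +_) (∑-++ as bs f) ⟩
    f x + (∑ as f + ∑ bs f)    ≡⟨ shuffle (f x) (∑ as f) (∑ bs f) ⟩
    ∑ as f + ∑ (x ∷ bs) f      ≡⟨ ∑-++ as (x ∷ bs) f ⟨
    ∑ (as ++ x ∷ bs) f         ∎
    where
    open ℕ.≤-Reasoning
    shuffle : ∀ a b c → a + (b + c) ≡ b + (a + c)
    shuffle = solve-∀
    cover′ : ∀ {y} → y ∈ xs → f y ≡ 0 ⊎ y ∈ as ++ bs
    cover′ y∈xs with cover (there y∈xs)
    ... | inj₁ fy≡0 = inj₁ fy≡0
    ... | inj₂ y∈ys with ∈-++⁻ as y∈ys
    ...   | inj₁ y∈as         = inj₂ (∈-++⁺ˡ y∈as)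
    ...   | inj₂ (here refl)  = contradiction refl (All.lookup x∉xs y∈xs)
    ...   | inj₂ (there y∈bs) = inj₂ (∈-++⁺ʳ as y∈bs)

  -- Passes from ordered pairs, where double counting works, to the unordered pairs among which
  -- edges are counted.
  ∑-unorderedPairs : ∀ (xs : List A) (h : A → A → ℕ) → (∀ x y → h x y ≡ h y x) →
    (∑[ x ∈ xs ] ∑[ y ∈ xs ] h x y) ≡ (∑[ x ∈ xs ] h x x) + 2 * ∑ (unorderedPairs xs) (uncurry h)
  ∑-unorderedPairs []       h h-sym = refl
  ∑-unorderedPairs (x ∷ xs) h h-sym = begin
    h x x + a + (∑[ y ∈ xs ] (h y x + ∑ xs (h y)))
      ≡⟨ cong (h x x + a +_) (∑-distrib-+ xs (λ y → h y x) (λ y → ∑ xs (h y))) ⟩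
    h x x + a + (∑ xs (λ y → h y x) + (∑[ y ∈ xs ] ∑ xs (h y)))
      ≡⟨ cong₂ (λ b s → h x x + a + (b + s)) (∑-cong xs (λ y → h-sym y x)) (∑-unorderedPairs xs h h-sym) ⟩
    h x x + a + (a + (d + 2 * p))
      ≡⟨ shuffle (h x x) a d p ⟩
    h x x + d + 2 * (a + p)
      ≡⟨ cong (λ a → h x x + d + 2 * (a + p)) (∑-map (x ,_) xs (uncurry h)) ⟨
    h x x + d + 2 * (∑ (map (x ,_) xs) (uncurry h) + p)
      ≡⟨ cong (λ s → h x x + d + 2 * s) (∑-++ (map (x ,_) xs) (unorderedPairs xs) (uncurry h)) ⟨
    h x x + d + 2 * ∑ (unorderedPairs (x ∷ xs)) (uncurry h) ∎
    where
    open ≡-Reasoning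
    a d p : ℕ
    a = ∑ xs (h x)
    d = ∑[ y ∈ xs ] h y y
    p = ∑ (unorderedPairs xs) (uncurry h)
    shuffle : ∀ h a d p → h + a + (a + (d + 2 * p)) ≡ h + d + 2 * (a + p)
    shuffle = solve-∀

  -- Shaped for 2i ≤ [i = 1] + i²: the excess over `g` is at most one unit for each element
  -- satisfying `P`, so their number pays for it.
  ∑-≤-filter : ∀ {P : A → Set} (P? : Decidable P) (xs : List A) {f g : A → ℕ} →
    (∀ x → P x → f x ≤ 1 + g x) → (∀ x → ¬ P x → f x ≤ g x) →
    ∑ xs f ≤ length (filter P? xs) + ∑ xs g
  ∑-≤-filter P? []       on off = z≤n
  ∑-≤-filter P? (x ∷ xs) {f} {g} on off with P? x
  ... | yes px = ℕ.≤-trans (ℕ.+-mono-≤ (on x px) (∑-≤-filter P? xs on off))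
    (ℕ.≤-reflexive (shuffle (g x) (length (filter P? xs)) (∑ xs g)))
    where
    shuffle : ∀ a l s → 1 + a + (l + s) ≡ 1 + l + (a + s)
    shuffle = solve-∀
  ... | no ¬px = ℕ.≤-trans (ℕ.+-mono-≤ (off x ¬px) (∑-≤-filter P? xs on off))
    (ℕ.≤-reflexive (shuffle (g x) (length (filter P? xs)) (∑ xs g)))
    where
    shuffle : ∀ a l s → a + (l + s) ≡ l + (a + s)
    shuffle = solve-∀

  -- AM-GM and Cauchy-Schwarz over the natural numbers.

  2ab≤a²+b² : ∀ a b → 2 * (a * b) ≤ a * a + b * b
  2ab≤a²+b² a b with ℕ.≤-total a b
  ... | inj₁ a≤b with d , refl ← ℕ.m≤n⇒∃[o]m+o≡n a≤b =
    ℕ.≤-trans (ℕ.m≤m+n _ (d * d)) (ℕ.≤-reflexive (square a d))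
    where
    square : ∀ a d → 2 * (a * (a + d)) + d * d ≡ a * a + (a + d) * (a + d)
    square = solve-∀
  ... | inj₂ b≤a with d , refl ← ℕ.m≤n⇒∃[o]m+o≡n b≤a =
    ℕ.≤-trans (ℕ.m≤m+n _ (d * d)) (ℕ.≤-reflexive (square b d))
    where
    square : ∀ b d → 2 * ((b + d) * b) + d * d ≡ (b + d) * (b + d) + b * b
    square = solve-∀

  -- Induction on the list: expanding the square leaves the cross term 2as, which AM-GM bounds
  -- summand by summand.
  cauchy-schwarz : ∀ (xs : List A) (f : A → ℕ) →
    ∑ xs f * ∑ xs f ≤ length xs * (∑[ x ∈ xs ] (f x * f x))
  cauchy-schwarz []       f = z≤n
  cauchy-schwarz (x ∷ xs) f = begin
    (a + s) * (a + s)                       ≡⟨ expand a s ⟩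
    a * a + 2 * (a * s) + s * s             ≤⟨ ℕ.+-mono-≤ (ℕ.+-monoʳ-≤ (a * a) cross) (cauchy-schwarz xs f) ⟩
    a * a + (l * (a * a) + q) + l * q       ≡⟨ collect a l q ⟩
    (1 + l) * (a * a + q)                   ∎
    where
    open ℕ.≤-Reasoning
    a s l q : ℕ
    a = f x
    s = ∑ xs f
    l = length xs
    q = ∑[ y ∈ xs ] (f y * f y)
    expand : ∀ a s → (a + s) * (a + s) ≡ a * a + 2 * (a * s) + s * s
    expand = solve-∀
    collect : ∀ a l q → a * a + (l * (a * a) + q) + l * q ≡ (1 + l) * (a * a + q)
    collect = solve-∀
    cross : 2 * (a * s) ≤ l * (a * a) + q
    cross = begin
      2 * (a * s)                            ≡⟨ cong (2 *_) (*-distribˡ-∑ a xs f) ⟨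
      2 * (∑[ y ∈ xs ] (a * f y))            ≡⟨ *-distribˡ-∑ 2 xs (λ y → a * f y) ⟨
      ∑[ y ∈ xs ] (2 * (a * f y))            ≤⟨ ∑-mono xs (λ y → 2ab≤a²+b² a (f y)) ⟩
      ∑[ y ∈ xs ] (a * a + f y * f y)        ≡⟨ ∑-distrib-+ xs (λ _ → a * a) (λ y → f y * f y) ⟩
      (∑[ y ∈ xs ] (a * a)) + q              ≡⟨ cong (_+ q) (∑-const xs (a * a)) ⟩
      l * (a * a) + q                        ∎

  -- Indicator functions and the points of a 3-element set.

  χ : Subset n → Fin n → ℕ
  χ s x = if lookup s x then 1 else 0

  -- Makes intersection sizes bilinear in the indicators, so that sums over triples and over points
  -- can be exchanged.
  ∣∩∣≡∑ : ∀ (s t : Subset n) → ∣ s ∩ t ∣ ≡ ∑[ x ∈ allFin n ] (χ s x * χ t x)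
  ∣∩∣≡∑ [] [] = refl
  ∣∩∣≡∑ {suc n} (a ∷ s) (b ∷ t) =
    trans (head a b) (sym (∑-allFin-suc n (λ x → χ (a ∷ s) x * χ (b ∷ t) x)))
    where
    head : ∀ a b → ∣ (a ∷ s) ∩ (b ∷ t) ∣ ≡
      χ (a ∷ s) zero * χ (b ∷ t) zero + (∑[ x ∈ allFin n ] (χ s x * χ t x))
    head inside  inside  = cong suc (∣∩∣≡∑ s t)
    head inside  outside = ∣∩∣≡∑ s t
    head outside b       = ∣∩∣≡∑ s t

  remove : Fin n → Subset n → Subset n
  remove x s = s [ x ]≔ outside

  insert : Fin n → Subset n → Subset n
  insert x s = s [ x ]≔ inside

  insert-remove : ∀ {x} {s : Subset n} → x ∈ₛ s → insert x (remove x s) ≡ s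
  insert-remove here        = refl
  insert-remove (there x∈s) = cong (_ ∷_) (insert-remove x∈s)

  ∣remove∣ : ∀ {x} {s : Subset n} → x ∈ₛ s → ∣ s ∣ ≡ suc ∣ remove x s ∣
  ∣remove∣ here                    = refl
  ∣remove∣ (there {y = inside}  x∈s) = cong suc (∣remove∣ x∈s)
  ∣remove∣ (there {y = outside} x∈s) = ∣remove∣ x∈s

  ∑-remove : ∀ {x} {s : Subset n} → x ∈ₛ s → (f : Fin n → ℕ) →
    (∑[ w ∈ allFin n ] (χ s w * f w)) ≡ f x + (∑[ w ∈ allFin n ] (χ (remove x s) w * f w))
  ∑-remove {n = suc n} {s = _ ∷ s} here f = begin
    (∑[ w ∈ allFin (suc n) ] (χ (inside ∷ s) w * f w))
      ≡⟨ ∑-allFin-suc n _ ⟩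
    f zero + 0 + rest
      ≡⟨ cong (_+ rest) (ℕ.+-identityʳ (f zero)) ⟩
    f zero + rest
      ≡⟨ cong (f zero +_) (∑-allFin-suc n (λ w → χ (outside ∷ s) w * f w)) ⟨
    f zero + (∑[ w ∈ allFin (suc n) ] (χ (outside ∷ s) w * f w)) ∎
    where
    open ≡-Reasoning
    rest : ℕ
    rest = ∑[ w ∈ allFin n ] (χ s w * f (suc w))
  ∑-remove {n = suc n} {x = suc x} {s = a ∷ s} (there x∈s) f = begin
    (∑[ w ∈ allFin (suc n) ] (χ (a ∷ s) w * f w))
      ≡⟨ ∑-allFin-suc n _ ⟩
    b + (∑[ w ∈ allFin n ] (χ s w * f (suc w)))
      ≡⟨ cong (b +_) (∑-remove x∈s (f ∘ suc)) ⟩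
    b + (f (suc x) + rest)
      ≡⟨ shuffle b (f (suc x)) rest ⟩
    f (suc x) + (b + rest)
      ≡⟨ cong (f (suc x) +_) (∑-allFin-suc n (λ w → χ (a ∷ remove x s) w * f w)) ⟨
    f (suc x) + (∑[ w ∈ allFin (suc n) ] (χ (a ∷ remove x s) w * f w)) ∎
    where
    open ≡-Reasoning
    b rest : ℕ
    b    = χ (a ∷ s) zero * f zero
    rest = ∑[ w ∈ allFin n ] (χ (remove x s) w * f (suc w))
    shuffle : ∀ a b c → a + (b + c) ≡ b + (a + c)
    shuffle = solve-∀

  ∈-remove⁻ : ∀ {x y} {s : Subset n} → y ∈ₛ remove x s → y ≢ x × y ∈ₛ s
  ∈-remove⁻ {x = zero}  {s = _ ∷ s} (there y∈s) = (λ ()) , there y∈s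
  ∈-remove⁻ {x = suc x} {s = _ ∷ s} here        = (λ ()) , here
  ∈-remove⁻ {x = suc x} {s = _ ∷ s} (there y∈)  with y≢x , y∈s ← ∈-remove⁻ y∈ =
    y≢x ∘ Fin.suc-injective , there y∈s

  ∣s∣≡0⇒s≡⊥ : ∀ {s : Subset n} → ∣ s ∣ ≡ 0 → s ≡ ⊥
  ∣s∣≡0⇒s≡⊥ {s = []}          _   = refl
  ∣s∣≡0⇒s≡⊥ {s = outside ∷ s} s≡0 = cong (outside ∷_) (∣s∣≡0⇒s≡⊥ s≡0)

  ∣s∣≡suc⇒nonempty : ∀ {s : Subset n} → ∣ s ∣ ≡ suc k → ∃[ x ] x ∈ₛ s
  ∣s∣≡suc⇒nonempty {s = inside ∷ s}  _  = zero , here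
  ∣s∣≡suc⇒nonempty {s = outside ∷ s} eq with x , x∈s ← ∣s∣≡suc⇒nonempty {s = s} eq =
    suc x , there x∈s

  ∑-χ-⊥ : ∀ (f : Fin n → ℕ) → (∑[ w ∈ allFin n ] (χ ⊥ w * f w)) ≡ 0
  ∑-χ-⊥ {zero}  f = refl
  ∑-χ-⊥ {suc n} f = trans (∑-allFin-suc n (λ w → χ ⊥ w * f w)) (∑-χ-⊥ (f ∘ suc))

  triple : Fin n → Fin n → Fin n → Subset n
  triple x y z = insert x (insert y (insert z ⊥))

  -- `≡triple` serves for counting triples by their points; `∑-χ` turns a sum weighted by the
  -- indicator of `s` into three terms.
  record IsTriple (s : Subset n) (x y z : Fin n) : Set where
    field
      ≡triple : s ≡ triple x y z
      x≢y     : x ≢ y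
      x≢z     : x ≢ z
      y≢z     : y ≢ z
      ∑-χ     : ∀ (f : Fin _ → ℕ) → (∑[ w ∈ allFin n ] (χ s w * f w)) ≡ f x + (f y + f z)

  -- Removing x and then y leaves a set of size 1. Its element is z, and once z is removed as well
  -- nothing remains, so reinserting the three points rebuilds s.
  complete-pair : ∀ {s : Subset n} {x y} → ∣ s ∣ ≡ 3 → x ∈ₛ s → y ∈ₛ s → x ≢ y →
    ∃[ z ] IsTriple s x y z
  complete-pair {s = s} {x} {y} ∣s∣≡3 x∈s y∈s x≢y = z , record
    { ≡triple = begin
        s
          ≡⟨ insert-remove x∈s ⟨
        insert x s₁
          ≡⟨ cong (insert x) (insert-remove y∈s₁) ⟨
        insert x (insert y s₂)
          ≡⟨ cong (insert x ∘ insert y) (insert-remove z∈s₂) ⟨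
        insert x (insert y (insert z s₃))
          ≡⟨ cong (triple′ x y z) s₃≡⊥ ⟩
        triple x y z ∎
    ; x≢y = x≢y
    ; x≢z = proj₁ (∈-remove⁻ z∈s₁) ∘ sym
    ; y≢z = proj₁ (∈-remove⁻ z∈s₂) ∘ sym
    ; ∑-χ = λ f → begin
        (∑[ w ∈ allFin _ ] (χ s w * f w))
          ≡⟨ ∑-remove x∈s f ⟩
        f x + (∑[ w ∈ allFin _ ] (χ s₁ w * f w))
          ≡⟨ cong (f x +_) (∑-remove y∈s₁ f) ⟩
        f x + (f y + (∑[ w ∈ allFin _ ] (χ s₂ w * f w)))
          ≡⟨ cong (λ k → f x + (f y + k)) (∑-remove z∈s₂ f) ⟩
        f x + (f y + (f z + (∑[ w ∈ allFin _ ] (χ s₃ w * f w))))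
          ≡⟨ cong (λ s → f x + (f y + (f z + (∑[ w ∈ allFin _ ] (χ s w * f w))))) s₃≡⊥ ⟩
        f x + (f y + (f z + (∑[ w ∈ allFin _ ] (χ ⊥ w * f w))))
          ≡⟨ cong (λ k → f x + (f y + (f z + k))) (∑-χ-⊥ f) ⟩
        f x + (f y + (f z + 0))
          ≡⟨ cong (λ k → f x + (f y + k)) (ℕ.+-identityʳ (f z)) ⟩
        f x + (f y + f z) ∎
    }
    where
    open ≡-Reasoning
    triple′ : Fin _ → Fin _ → Fin _ → Subset _ → Subset _
    triple′ x y z t = insert x (insert y (insert z t))
    s₁ = remove x s
    y∈s₁ : y ∈ₛ s₁
    y∈s₁ = []≔-minimal s y x (x≢y ∘ sym) y∈s
    s₂ = remove y s₁
    ∣s₂∣≡1 : ∣ s₂ ∣ ≡ 1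
    ∣s₂∣≡1 = ℕ.suc-injective (trans (sym (∣remove∣ y∈s₁))
               (ℕ.suc-injective (trans (sym (∣remove∣ x∈s)) ∣s∣≡3)))
    third = ∣s∣≡suc⇒nonempty ∣s₂∣≡1
    z = proj₁ third
    z∈s₂ : z ∈ₛ s₂
    z∈s₂ = proj₂ third
    z∈s₁ : z ∈ₛ s₁
    z∈s₁ = proj₂ (∈-remove⁻ z∈s₂)
    s₃ = remove z s₂
    s₃≡⊥ : s₃ ≡ ⊥
    s₃≡⊥ = ∣s∣≡0⇒s≡⊥ (ℕ.suc-injective (trans (sym (∣remove∣ z∈s₂)) ∣s₂∣≡1))

  split-triple : ∀ {s : Subset n} → ∣ s ∣ ≡ 3 →
    Σ (Fin n × Fin n × Fin n) λ (x , y , z) → IsTriple s x y z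
  split-triple {s = s} ∣s∣≡3 =
    let x , x∈s  = ∣s∣≡suc⇒nonempty ∣s∣≡3
        y , y∈s₁ = ∣s∣≡suc⇒nonempty {s = remove x s}
                     (ℕ.suc-injective (trans (sym (∣remove∣ x∈s)) ∣s∣≡3))
        y≢x , y∈s = ∈-remove⁻ y∈s₁
        z , t = complete-pair ∣s∣≡3 x∈s y∈s (y≢x ∘ sym)
    in (x , y , z) , t

  -- Bounding three codegrees by the largest one and by products.

  private
    max-bound : ∀ l {n} a b c → a ≤ n → b ≤ a → c ≤ a →
      l * (a + b + c) ≤ l * n + l * l + (a * b + b * c + a * c)
    max-bound l {n} a b c a≤n b≤a c≤a = ℕ.*-cancelˡ-≤ 2 (begin
      2 * (l * (a + b + c))
        ≡⟨ expand l a b c ⟩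
      2 * (l * a) + (2 * (l * b) + 2 * (l * c))
        ≤⟨ ℕ.+-mono-≤ (ℕ.*-monoʳ-≤ 2 (ℕ.*-monoʳ-≤ l a≤n))
             (ℕ.+-mono-≤ (2ab≤a²+b² l b) (2ab≤a²+b² l c)) ⟩
      2 * (l * n) + (l * l + b * b + (l * l + c * c))
        ≤⟨ ℕ.+-monoʳ-≤ (2 * (l * n)) (ℕ.+-mono-≤ (ℕ.+-monoʳ-≤ (l * l) (ℕ.*-monoˡ-≤ b b≤a))
             (ℕ.+-monoʳ-≤ (l * l) (ℕ.*-monoˡ-≤ c c≤a))) ⟩
      2 * (l * n) + (l * l + a * b + (l * l + a * c))
        -- AM-GM uses only one copy each of ab and ac. The padding makes the bound symmetric in a,
        -- b, c, so that the other orderings follow by permuting.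
        ≤⟨ ℕ.m≤m+n _ (a * b + 2 * (b * c) + a * c) ⟩
      2 * (l * n) + (l * l + a * b + (l * l + a * c)) + (a * b + 2 * (b * c) + a * c)
        ≡⟨ collect (l * n) (l * l) (a * b) (b * c) (a * c) ⟩
      2 * (l * n + l * l + (a * b + b * c + a * c)) ∎)
      where
      open ℕ.≤-Reasoning
      expand : ∀ l a b c → 2 * (l * (a + b + c)) ≡ 2 * (l * a) + (2 * (l * b) + 2 * (l * c))
      expand = solve-∀
      collect : ∀ ln ll ab bc ac →
        2 * ln + (ll + ab + (ll + ac)) + (ab + 2 * bc + ac) ≡ 2 * (ln + ll + (ab + bc + ac))
      collect = solve-∀

  -- Only the largest of a, b, c needs the bound n; the other two are absorbed by
  -- 2lb ≤ l² + b² and b² ≤ ab, that is, by products of two of the three numbers.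
  l[a+b+c]≤ : ∀ l {n} a b c → a ≤ n → b ≤ n → c ≤ n →
    l * (a + b + c) ≤ l * n + l * l + (a * b + b * c + a * c)
  l[a+b+c]≤ l {n} a b c a≤n b≤n c≤n with ℕ.≤-total a b | ℕ.≤-total a c | ℕ.≤-total b c
  ... | inj₂ b≤a | inj₂ c≤a | _        = max-bound l a b c a≤n b≤a c≤a
  ... | inj₁ a≤b | _        | inj₂ c≤b =
    subst₂ _≤_ (cong (l *_) (rotate a b c)) (cong (l * n + l * l +_) (products a b c))
      (max-bound l b a c b≤n a≤b c≤b)
    where
    rotate : ∀ a b c → b + a + c ≡ a + b + c
    rotate = solve-∀
    products : ∀ a b c → b * a + a * c + b * c ≡ a * b + b * c + a * c
    products = solve-∀
  ... | inj₁ a≤b | _        | inj₁ b≤c =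
    subst₂ _≤_ (cong (l *_) (rotate a b c)) (cong (l * n + l * l +_) (products a b c))
      (max-bound l c a b c≤n (ℕ.≤-trans a≤b b≤c) b≤c)
    where
    rotate : ∀ a b c → c + a + b ≡ a + b + c
    rotate = solve-∀
    products : ∀ a b c → c * a + a * b + c * b ≡ a * b + b * c + a * c
    products = solve-∀
  ... | inj₂ b≤a | inj₁ a≤c | _        =
    subst₂ _≤_ (cong (l *_) (rotate a b c)) (cong (l * n + l * l +_) (products a b c))
      (max-bound l c a b c≤n a≤c (ℕ.≤-trans b≤a a≤c))
    where
    rotate : ∀ a b c → c + a + b ≡ a + b + c
    rotate = solve-∀
    products : ∀ a b c → c * a + a * b + c * b ≡ a * b + b * c + a * c
    products = solve-∀

  -- Double counting with degrees and codegrees.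

  module _ {n : ℕ} (U : VertexSubset J[ n ,3,⟨1⟩]) where
    open SimpleGraph J[ n ,3,⟨1⟩] using (Vertex)
    open VertexSubset U

    private
      pts : List (Fin n)
      pts = allFin n

      ∣pts∣≡n : length pts ≡ n
      ∣pts∣≡n = length-tabulate id

      χᵥ : Vertex → Fin n → ℕ
      χᵥ v = χ (proj₁ v)

      inter : Vertex → Vertex → ℕ
      inter u v = ∣ proj₁ u ∩ proj₁ v ∣

      corners : Vertex → Fin n × Fin n × Fin n
      corners v = proj₁ (split-triple {s = proj₁ v} (proj₂ v))

      module Corners (v : Vertex) where
        x y z : Fin n
        x = proj₁ (corners v)
        y = proj₁ (proj₂ (corners v))
        z = proj₂ (proj₂ (corners v))
        open IsTriple (proj₂ (split-triple {s = proj₁ v} (proj₂ v))) public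

      proj₁-injective : ∀ {u v : Vertex} → proj₁ u ≡ proj₁ v → u ≡ v
      proj₁-injective {_ , p} {_ , q} refl = cong (_ ,_) (ℕ.≡-irrelevant p q)

      -- The corners rebuild the underlying set, and the proof that its size is 3 is unique. Hence
      -- triples of U embed into Fin n × Fin n × Fin n.
      corners-injective : ∀ {u v} → corners u ≡ corners v → u ≡ v
      corners-injective {u} {v} eq = proj₁-injective
        (trans (Corners.≡triple u)
          (trans (cong (λ (x , y , z) → triple x y z) eq) (sym (Corners.≡triple v))))

    -- With the letters of the overview, `deg` is d(x), `codeg` is d(x,y), `∑deg²` is S and `∑codeg`
    -- is w(T). Equal arguments are allowed in `codeg`, so that it can be summed over all points
    -- without side conditions.
    deg : Fin n → ℕ
    deg x = ∑[ v ∈ elements ] χᵥ v x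

    codeg : Fin n → Fin n → ℕ
    codeg x y = ∑[ v ∈ elements ] (χᵥ v x * χᵥ v y)

    ∑deg² : ℕ
    ∑deg² = ∑[ x ∈ pts ] (deg x * deg x)

    ∑codeg : Vertex → ℕ
    ∑codeg v = codeg x y + codeg y z + codeg x z
      where open Corners v

    codeg-comm : ∀ x y → codeg x y ≡ codeg y x
    codeg-comm x y = ∑-cong elements (λ v → ℕ.*-comm (χᵥ v x) (χᵥ v y))

    codeg-diag : ∀ x → codeg x x ≡ deg x
    codeg-diag x = ∑-cong elements (λ v → χ-idem (proj₁ v))
      where
      χ-idem : ∀ s → χ s x * χ s x ≡ χ s x
      χ-idem s with lookup s x
      ... | inside  = refl
      ... | outside = refl

    ∑χ≡3 : ∀ v → ∑ pts (χᵥ v) ≡ 3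
    ∑χ≡3 v = trans (∑-cong pts (λ x → sym (ℕ.*-identityʳ (χᵥ v x)))) (Corners.∑-χ v (λ _ → 1))

    ∑deg : ∑ pts deg ≡ size U * 3
    ∑deg = trans (∑-comm pts elements (λ x v → χᵥ v x))
      (trans (∑-cong elements ∑χ≡3) (∑-const elements 3))

    -- A triple through two distinct points is determined by its third point, for which `pts` offers
    -- n candidates. The degenerate candidates z = x and z = y only enlarge the bound.
    codeg≤n : ∀ {x y} → x ≢ y → codeg x y ≤ n
    codeg≤n {x} {y} x≢y = begin
      codeg x y
        ≡⟨ ∑-map proj₁ elements (λ s → χ s x * χ s y) ⟨
      ∑[ s ∈ map proj₁ elements ] (χ s x * χ s y)
        ≤⟨ ∑-≤-support (Unique.map⁺ proj₁-injective unique) cover ⟩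
      ∑[ s ∈ map (triple x y) pts ] (χ s x * χ s y)
        ≤⟨ ∑-mono (map (triple x y) pts) (λ s → ℕ.*-mono-≤ (χ≤1 s x) (χ≤1 s y)) ⟩
      ∑[ _ ∈ map (triple x y) pts ] 1
        ≡⟨ ∑-const (map (triple x y) pts) 1 ⟩
      length (map (triple x y) pts) * 1
        ≡⟨ ℕ.*-identityʳ _ ⟩
      length (map (triple x y) pts)
        ≡⟨ trans (length-map (triple x y) pts) ∣pts∣≡n ⟩
      n ∎
      where
      open ℕ.≤-Reasoning
      χ≤1 : ∀ s x → χ s x ≤ 1
      χ≤1 s x with lookup s x
      ... | inside  = ℕ.≤-refl
      ... | outside = z≤n
      χ≡0⊎∈ : ∀ s x → χ s x ≡ 0 ⊎ x ∈ₛ s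
      χ≡0⊎∈ s x with lookup s x in eq
      ... | inside  = inj₂ (lookup⇒[]= x s eq)
      ... | outside = inj₁ refl
      cover : ∀ {s} → s ∈ map proj₁ elements → χ s x * χ s y ≡ 0 ⊎ s ∈ map (triple x y) pts
      cover {s} s∈ with (_ , ∣s∣≡3) , _ , refl ← ∈-map⁻ proj₁ s∈ | χ≡0⊎∈ s x | χ≡0⊎∈ s y
      ... | inj₁ χx≡0 | _         = inj₁ (cong (_* χ s y) χx≡0)
      ... | inj₂ _    | inj₁ χy≡0 = inj₁ (trans (cong (χ s x *_) χy≡0) (ℕ.*-zeroʳ (χ s x)))
      ... | inj₂ x∈s  | inj₂ y∈s with z , t ← complete-pair ∣s∣≡3 x∈s y∈s x≢y =
        inj₂ (subst (_∈ map (triple x y) pts) (sym (IsTriple.≡triple t))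
                    (∈-map⁺ (triple x y) (∈-allFin z)))

    -- Both sides count pairs of triples together with a common point; for a fixed point x there are
    -- d(x)² such pairs.
    ∑-inter : (∑[ u ∈ elements ] ∑[ v ∈ elements ] inter u v) ≡ ∑deg²
    ∑-inter = begin
      (∑[ u ∈ elements ] ∑[ v ∈ elements ] inter u v)
        ≡⟨ ∑-cong elements (λ u → trans (∑-cong elements (λ v → ∣∩∣≡∑ (proj₁ u) (proj₁ v)))
             (∑-comm elements pts (λ v x → χᵥ u x * χᵥ v x))) ⟩
      (∑[ u ∈ elements ] ∑[ x ∈ pts ] ∑[ v ∈ elements ] (χᵥ u x * χᵥ v x))
        ≡⟨ ∑-comm elements pts _ ⟩
      (∑[ x ∈ pts ] ∑[ u ∈ elements ] ∑[ v ∈ elements ] (χᵥ u x * χᵥ v x))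
        ≡⟨ ∑-cong pts (λ x → ∑-*-∑ elements elements (λ u → χᵥ u x) (λ v → χᵥ v x)) ⟩
      ∑deg² ∎
      where open ≡-Reasoning

    -- The square of an intersection size counts ordered pairs (x,y) of common points. For fixed u,
    -- summing over v first gives d(x,y) for all x, y in u; pairs with x = y contribute degrees, and
    -- each other pair occurs in both orders.
    ∑-inter² : (∑[ u ∈ elements ] ∑[ v ∈ elements ] (inter u v * inter u v)) ≡
               ∑deg² + 2 * ∑ elements ∑codeg
    ∑-inter² = begin
      (∑[ u ∈ elements ] ∑[ v ∈ elements ] (inter u v * inter u v))
        ≡⟨ ∑-cong elements row ⟩
      (∑[ u ∈ elements ] (∑[ x ∈ pts ] (χᵥ u x * deg x)) + 2 * ∑codeg u)
        ≡⟨ ∑-distrib-+ elements _ _ ⟩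
      (∑[ u ∈ elements ] ∑[ x ∈ pts ] (χᵥ u x * deg x)) + (∑[ u ∈ elements ] (2 * ∑codeg u))
        ≡⟨ cong₂ _+_ diagonal (*-distribˡ-∑ 2 elements ∑codeg) ⟩
      ∑deg² + 2 * ∑ elements ∑codeg ∎
      where
      open ≡-Reasoning
      diagonal : (∑[ u ∈ elements ] ∑[ x ∈ pts ] (χᵥ u x * deg x)) ≡ ∑deg²
      diagonal = trans (∑-comm elements pts _)
        (∑-cong pts (λ x → *-distribʳ-∑ (deg x) elements (λ u → χᵥ u x)))
      square : ∀ u v → inter u v * inter u v ≡
        (∑[ x ∈ pts ] ∑[ y ∈ pts ] (χᵥ u x * (χᵥ u y * (χᵥ v x * χᵥ v y))))
      square u v = trans (cong₂ _*_ (∣∩∣≡∑ (proj₁ u) (proj₁ v)) (∣∩∣≡∑ (proj₁ u) (proj₁ v)))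
        (trans (sym (∑-*-∑ pts pts (λ x → χᵥ u x * χᵥ v x) (λ y → χᵥ u y * χᵥ v y)))
          (∑-cong pts (λ x → ∑-cong pts (λ y → shuffle (χᵥ u x) (χᵥ v x) (χᵥ u y) (χᵥ v y)))))
        where
        shuffle : ∀ a b c d → (a * b) * (c * d) ≡ a * (c * (b * d))
        shuffle = solve-∀
      factor : ∀ u x y → (∑[ v ∈ elements ] (χᵥ u x * (χᵥ u y * (χᵥ v x * χᵥ v y)))) ≡
        χᵥ u x * (χᵥ u y * codeg x y)
      factor u x y = trans (*-distribˡ-∑ (χᵥ u x) elements _)
        (cong (χᵥ u x *_) (*-distribˡ-∑ (χᵥ u y) elements _))
      row : ∀ u → (∑[ v ∈ elements ] (inter u v * inter u v)) ≡
        (∑[ x ∈ pts ] (χᵥ u x * deg x)) + 2 * ∑codeg u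
      row u = begin
        (∑[ v ∈ elements ] (inter u v * inter u v))
          ≡⟨ ∑-cong elements (square u) ⟩
        (∑[ v ∈ elements ] ∑[ x ∈ pts ] ∑[ y ∈ pts ] (χᵥ u x * (χᵥ u y * (χᵥ v x * χᵥ v y))))
          ≡⟨ ∑-comm elements pts _ ⟩
        (∑[ x ∈ pts ] ∑[ v ∈ elements ] ∑[ y ∈ pts ] (χᵥ u x * (χᵥ u y * (χᵥ v x * χᵥ v y))))
          ≡⟨ ∑-cong pts (λ x → trans (∑-comm elements pts _)
               (trans (∑-cong pts (factor u x)) (*-distribˡ-∑ (χᵥ u x) pts _))) ⟩
        (∑[ x ∈ pts ] (χᵥ u x * (∑[ y ∈ pts ] (χᵥ u y * codeg x y))))
          -- Both sums are weighted by the indicator of u. Collapsing them leaves nine codegrees at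
          -- the corners of u: three diagonal ones and six that are equal in pairs.
          ≡⟨ ∑-cong pts (λ w → cong (χᵥ u w *_) (∑-χ (codeg w))) ⟩
        (∑[ w ∈ pts ] (χᵥ u w * (codeg w x + (codeg w y + codeg w z))))
          ≡⟨ ∑-χ _ ⟩
        (codeg x x + (codeg x y + codeg x z)) +
          ((codeg y x + (codeg y y + codeg y z)) + (codeg z x + (codeg z y + codeg z z)))
          ≡⟨ cong₂ (λ a b → a + (codeg x y + codeg x z) + b) (codeg-diag x)
               (cong₂ _+_ (cong₂ (λ a b → a + (b + codeg y z)) (codeg-comm y x) (codeg-diag y))
                 (cong₂ _+_ (codeg-comm z x) (cong₂ _+_ (codeg-comm z y) (codeg-diag z)))) ⟩
        (deg x + (codeg x y + codeg x z)) +
          ((codeg x y + (deg y + codeg y z)) + (codeg x z + (codeg y z + deg z)))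
          ≡⟨ shuffle (deg x) (deg y) (deg z) (codeg x y) (codeg y z) (codeg x z) ⟩
        (deg x + (deg y + deg z)) + 2 * ∑codeg u
          ≡⟨ cong (_+ 2 * ∑codeg u) (∑-χ deg) ⟨
        (∑[ x ∈ pts ] (χᵥ u x * deg x)) + 2 * ∑codeg u ∎
        where
        open Corners u
        shuffle : ∀ a b c p q r →
          (a + (p + r)) + ((p + (b + q)) + (r + (q + c))) ≡ (a + (b + c)) + 2 * (p + q + r)
        shuffle = solve-∀

    2∑deg²≤ : 2 * ∑deg² ≤ 2 * numInducedEdges U + (∑deg² + 2 * ∑ elements ∑codeg)
    2∑deg²≤ = begin
      2 * ∑deg²
        ≡⟨ cong (2 *_) ∑-inter ⟨
      2 * (∑[ u ∈ elements ] ∑[ v ∈ elements ] inter u v)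
        ≡⟨ cong (2 *_) (∑-unorderedPairs elements inter inter-comm) ⟩
      2 * ((∑[ u ∈ elements ] inter u u) + 2 * ∑ pairs (uncurry inter))
        ≡⟨ regroup (∑[ u ∈ elements ] inter u u) (∑ pairs (uncurry inter)) ⟩
      2 * (∑[ u ∈ elements ] inter u u) + 2 * (2 * ∑ pairs (uncurry inter))
        ≡⟨ cong₂ (λ a b → a + 2 * b) (*-distribˡ-∑ 2 elements _) (*-distribˡ-∑ 2 pairs _) ⟨
      (∑[ u ∈ elements ] (2 * inter u u)) + 2 * (∑[ (u , v) ∈ pairs ] (2 * inter u v))
        ≤⟨ ℕ.+-mono-≤ (∑-mono elements diagonal) (ℕ.*-monoʳ-≤ 2
             (∑-≤-filter (λ (u , v) → inter u v ℕ.≟ 1) pairs adjacent nonadjacent)) ⟩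
      (∑[ u ∈ elements ] (inter u u * inter u u)) +
        2 * (e + (∑[ (u , v) ∈ pairs ] (inter u v * inter u v)))
        ≡⟨ regroup′ (∑[ u ∈ elements ] (inter u u * inter u u)) e _ ⟩
      2 * e + ((∑[ u ∈ elements ] (inter u u * inter u u)) +
        2 * (∑[ (u , v) ∈ pairs ] (inter u v * inter u v)))
        ≡⟨ cong (2 * e +_) (∑-unorderedPairs elements (λ u v → inter u v * inter u v)
             (λ u v → cong (λ i → i * i) (inter-comm u v))) ⟨
      2 * e + (∑[ u ∈ elements ] ∑[ v ∈ elements ] (inter u v * inter u v))
        ≡⟨ cong (2 * e +_) ∑-inter² ⟩
      2 * e + (∑deg² + 2 * ∑ elements ∑codeg) ∎
      where
      open ℕ.≤-Reasoning
      pairs : List (Vertex × Vertex)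
      pairs = unorderedPairs elements
      e : ℕ
      e = numInducedEdges U
      inter-comm : ∀ u v → inter u v ≡ inter v u
      inter-comm u v = cong ∣_∣ (∩-comm (proj₁ u) (proj₁ v))
      regroup : ∀ a b → 2 * (a + 2 * b) ≡ 2 * a + 2 * (2 * b)
      regroup = solve-∀
      regroup′ : ∀ a e b → a + 2 * (e + b) ≡ 2 * e + (a + 2 * b)
      regroup′ = solve-∀
      -- A triple meets itself in 3 points and 6 ≤ 9, so the diagonal needs no correction and only
      -- adjacent pairs cost a unit.
      diagonal : ∀ u → 2 * inter u u ≤ inter u u * inter u u
      diagonal u rewrite ∩-idem (proj₁ u) | proj₂ u = ℕ.m≤m+n 6 3
      adjacent : ∀ ((u , v) : Vertex × Vertex) → inter u v ≡ 1 →
        2 * inter u v ≤ 1 + inter u v * inter u v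
      adjacent _ i≡1 rewrite i≡1 = ℕ.≤-refl
      nonadjacent : ∀ ((u , v) : Vertex × Vertex) → inter u v ≢ 1 →
        2 * inter u v ≤ inter u v * inter u v
      nonadjacent (u , v) i≢1 with inter u v
      ... | 0           = z≤n
      ... | 1           = contradiction refl i≢1
      ... | suc (suc i) = ℕ.*-monoˡ-≤ (2 + i) (ℕ.m≤m+n 2 i)

    -- A triple is determined by its corners, so the sum over U of a function of the corners
    -- is at most its sum over Fin n × Fin n × Fin n.
    ∑-corners : ∀ (f : Fin n → Fin n → Fin n → ℕ) →
      (∑[ v ∈ elements ] f (Corners.x v) (Corners.y v) (Corners.z v)) ≤
      (∑[ x ∈ pts ] ∑[ y ∈ pts ] ∑[ z ∈ pts ] f x y z)
    ∑-corners f = begin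
      (∑[ v ∈ elements ] f (Corners.x v) (Corners.y v) (Corners.z v))
        ≡⟨ ∑-map corners elements f′ ⟨
      ∑ (map corners elements) f′
        ≤⟨ ∑-≤-support (Unique.map⁺ corners-injective unique) (λ {(x , y , z)} _ →
             inj₂ (∈-cartesianProduct⁺ (∈-allFin x) (∈-cartesianProduct⁺ (∈-allFin y) (∈-allFin z)))) ⟩
      ∑ (cartesianProduct pts (cartesianProduct pts pts)) f′
        ≡⟨ ∑-cartesianProduct pts (cartesianProduct pts pts) f′ ⟩
      (∑[ x ∈ pts ] ∑ (cartesianProduct pts pts) (λ (y , z) → f x y z))
        ≡⟨ ∑-cong pts (λ x → ∑-cartesianProduct pts pts (λ (y , z) → f x y z)) ⟩
      (∑[ x ∈ pts ] ∑[ y ∈ pts ] ∑[ z ∈ pts ] f x y z) ∎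
      where
      open ℕ.≤-Reasoning
      f′ : Fin n × Fin n × Fin n → ℕ
      f′ (x , y , z) = f x y z

    -- For fixed x the sums over y and z separate into a square. Since y = x is included, Σ_y d(x,y)
    -- is exactly 3 d(x), whence the factor 9.
    ∑-cherries : (∑[ x ∈ pts ] ∑[ y ∈ pts ] ∑[ z ∈ pts ] (codeg x y * codeg x z)) ≡ 9 * ∑deg²
    ∑-cherries = begin
      (∑[ x ∈ pts ] ∑[ y ∈ pts ] ∑[ z ∈ pts ] (codeg x y * codeg x z))
        ≡⟨ ∑-cong pts (λ x → ∑-*-∑ pts pts (codeg x) (codeg x)) ⟩
      (∑[ x ∈ pts ] (∑ pts (codeg x) * ∑ pts (codeg x)))
        ≡⟨ ∑-cong pts (λ x → trans (cong (λ k → k * k) (∑codeg≡ x)) (square (deg x))) ⟩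
      (∑[ x ∈ pts ] (9 * (deg x * deg x)))
        ≡⟨ *-distribˡ-∑ 9 pts _ ⟩
      9 * ∑deg² ∎
      where
      open ≡-Reasoning
      square : ∀ d → (d * 3) * (d * 3) ≡ 9 * (d * d)
      square = solve-∀
      ∑codeg≡ : ∀ x → ∑ pts (codeg x) ≡ deg x * 3
      ∑codeg≡ x = trans (∑-comm pts elements (λ y v → χᵥ v x * χᵥ v y))
        (trans (∑-cong elements (λ v → trans (*-distribˡ-∑ (χᵥ v x) pts (χᵥ v))
                                             (cong (χᵥ v x *_) (∑χ≡3 v))))
               (*-distribʳ-∑ 3 elements (λ v → χᵥ v x)))

    -- Sums `l[a+b+c]≤` over U. The three products of codegrees in a triple are centred at its three
    -- corners, and for each choice of corner they total at most 9 S; hence 27.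
    l*∑∑codeg≤ : ∀ l →
      l * ∑ elements ∑codeg ≤ size U * (l * n + l * l) + 27 * ∑deg²
    l*∑∑codeg≤ l = begin
      l * ∑ elements ∑codeg
        ≡⟨ *-distribˡ-∑ l elements ∑codeg ⟨
      (∑[ v ∈ elements ] (l * ∑codeg v))
        ≤⟨ ∑-mono elements (λ v → let open Corners v in
             l[a+b+c]≤ l (codeg x y) (codeg y z) (codeg x z)
               (codeg≤n x≢y) (codeg≤n y≢z) (codeg≤n x≢z)) ⟩
      (∑[ v ∈ elements ] (l * n + l * l + (at-y v + at-z v + at-x v)))
        ≡⟨ ∑-distrib-+ elements _ _ ⟩
      (∑[ v ∈ elements ] (l * n + l * l)) + (∑[ v ∈ elements ] (at-y v + at-z v + at-x v))
        ≡⟨ cong₂ _+_ (∑-const elements _) (trans (∑-distrib-+ elements _ at-x)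
             (cong (_+ ∑ elements at-x) (∑-distrib-+ elements at-y at-z))) ⟩
      size U * (l * n + l * l) + (∑ elements at-y + ∑ elements at-z + ∑ elements at-x)
        ≤⟨ ℕ.+-monoʳ-≤ (size U * (l * n + l * l)) (ℕ.+-mono-≤ (ℕ.+-mono-≤
             (ℕ.≤-trans (∑-corners (λ x y z → codeg x y * codeg y z)) (ℕ.≤-reflexive centre-y))
             (ℕ.≤-trans (∑-corners (λ x y z → codeg y z * codeg x z)) (ℕ.≤-reflexive centre-z)))
             (ℕ.≤-trans (∑-corners (λ x y z → codeg x y * codeg x z)) (ℕ.≤-reflexive ∑-cherries))) ⟩
      size U * (l * n + l * l) + (9 * ∑deg² + 9 * ∑deg² + 9 * ∑deg²)
        ≡⟨ cong (size U * (l * n + l * l) +_) (collect ∑deg²) ⟩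
      size U * (l * n + l * l) + 27 * ∑deg² ∎
      where
      open ℕ.≤-Reasoning
      at-x at-y at-z : Vertex → ℕ
      at-x v = let open Corners v in codeg x y * codeg x z
      at-y v = let open Corners v in codeg x y * codeg y z
      at-z v = let open Corners v in codeg y z * codeg x z
      collect : ∀ s → 9 * s + 9 * s + 9 * s ≡ 27 * s
      collect = solve-∀
      -- Exchanging sums brings the common point of the two codegrees to the outermost position, as
      -- in `∑-cherries`.
      centre-y : (∑[ x ∈ pts ] ∑[ y ∈ pts ] ∑[ z ∈ pts ] (codeg x y * codeg y z)) ≡ 9 * ∑deg²
      centre-y = trans (∑-comm pts pts _) (trans (∑-cong pts (λ y → ∑-cong pts (λ x → ∑-cong pts
        (λ z → cong (_* codeg y z) (codeg-comm x y))))) ∑-cherries)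
      centre-z : (∑[ x ∈ pts ] ∑[ y ∈ pts ] ∑[ z ∈ pts ] (codeg y z * codeg x z)) ≡ 9 * ∑deg²
      centre-z = trans (∑-cong pts (λ x → ∑-comm pts pts _)) (trans (∑-comm pts pts _)
        (trans (∑-cong pts (λ z → ∑-cong pts (λ x → ∑-cong pts (λ y →
          trans (ℕ.*-comm (codeg y z) (codeg x z)) (cong₂ _*_ (codeg-comm x z) (codeg-comm y z))))))
        ∑-cherries))

    9m²≤n∑deg² : 9 * (size U * size U) ≤ n * ∑deg²
    9m²≤n∑deg² = begin
      9 * (size U * size U)          ≡⟨ square (size U) ⟩
      size U * 3 * (size U * 3)      ≡⟨ cong (λ k → k * k) ∑deg ⟨
      ∑ pts deg * ∑ pts deg          ≤⟨ cauchy-schwarz pts deg ⟩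
      length pts * ∑deg²             ≡⟨ cong (_* ∑deg²) ∣pts∣≡n ⟩
      n * ∑deg²                      ∎
      where
      open ℕ.≤-Reasoning
      square : ∀ m → 9 * (m * m) ≡ m * 3 * (m * 3)
      square = solve-∀

  -- Integer square roots.

  isqrt : ℕ → ℕ
  isqrt zero    = 0
  isqrt (suc n) with suc (isqrt n) * suc (isqrt n) ℕ.≤? suc n
  ... | yes _ = suc (isqrt n)
  ... | no  _ = isqrt n

  isqrt²≤ : ∀ n → isqrt n * isqrt n ≤ n
  isqrt²≤ zero    = z≤n
  isqrt²≤ (suc n) with suc (isqrt n) * suc (isqrt n) ℕ.≤? suc n
  ... | yes p = p
  ... | no  _ = ℕ.m≤n⇒m≤1+n (isqrt²≤ n)

  <[1+isqrt]² : ∀ n → n < suc (isqrt n) * suc (isqrt n)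
  <[1+isqrt]² zero    = s≤s z≤n
  <[1+isqrt]² (suc n) with suc (isqrt n) * suc (isqrt n) ℕ.≤? suc n
  ... | yes _  = ℕ.≤-<-trans (<[1+isqrt]² n)
    (ℕ.*-mono-< (ℕ.n<1+n (suc (isqrt n))) (ℕ.n<1+n (suc (isqrt n))))
  ... | no  ¬p = ℕ.≰⇒> ¬p

  k²≤n⇒k≤isqrt : ∀ {k n} → k * k ≤ n → k ≤ isqrt n
  k²≤n⇒k≤isqrt {k} {n} k²≤n with k ℕ.≤? isqrt n
  ... | yes k≤ = k≤
  ... | no  k≰ = contradiction (<[1+isqrt]² n)
    (ℕ.≤⇒≯ (ℕ.≤-trans (ℕ.*-mono-≤ (ℕ.≰⇒> k≰) (ℕ.≰⇒> k≰)) k²≤n))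

  -- The argument is positive, so its root s is at least 1 and 1 + s ≤ 2s.
  [1+isqrt]²≤4n : ∀ n → suc (isqrt (suc n)) * suc (isqrt (suc n)) ≤ 4 * suc n
  [1+isqrt]²≤4n n = begin
    suc s * suc s            ≤⟨ ℕ.*-mono-≤ 1+s≤2s 1+s≤2s ⟩
    (s + s) * (s + s)        ≡⟨ square s ⟩
    4 * (s * s)              ≤⟨ ℕ.*-monoʳ-≤ 4 (isqrt²≤ (suc n)) ⟩
    4 * suc n                ∎
    where
    open ℕ.≤-Reasoning
    s : ℕ
    s = isqrt (suc n)
    1+s≤2s : suc s ≤ s + s
    1+s≤2s = ℕ.+-monoˡ-≤ s (k²≤n⇒k≤isqrt {1} {suc n} (s≤s z≤n))
    square : ∀ s → (s + s) * (s + s) ≡ 4 * (s * s)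
    square = solve-∀

  -- The edge bound in natural numbers.

  module _ {n : ℕ} (U : VertexSubset J[ n ,3,⟨1⟩]) where
    open VertexSubset U using (elements)

    private
      m e d : ℕ
      m = size U
      e = numInducedEdges U
      d = ∑deg² U

    -- The choice l = 54 (s + 1) turns the error term 2 · 27 S into l S / (s + 1).
    s*∑deg²≤ : ∀ s → s * d ≤ 2 * e * suc s + 2 * m * n * suc s + 108 * m * (suc s * suc s)
    s*∑deg²≤ s = ℕ.*-cancelˡ-≤ 54 (ℕ.+-cancelʳ-≤ (27 * d + 27 * d + l * d) _ _ (begin
      54 * (s * d) + (27 * d + 27 * d + l * d)
        ≡⟨ expand s d ⟩
      l * (2 * d)
        ≤⟨ ℕ.*-monoʳ-≤ l (2∑deg²≤ U) ⟩
      l * (2 * e + (d + 2 * w))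
        ≡⟨ regroup l e d w ⟩
      l * (2 * e) + l * d + (l * w + l * w)
        ≤⟨ ℕ.+-monoʳ-≤ (l * (2 * e) + l * d) (ℕ.+-mono-≤ (l*∑∑codeg≤ U l) (l*∑∑codeg≤ U l)) ⟩
      l * (2 * e) + l * d + (m * (l * n + l * l) + 27 * d + (m * (l * n + l * l) + 27 * d))
        ≡⟨ collect s e d m n ⟩
      54 * (2 * e * suc s + 2 * m * n * suc s + 108 * m * (suc s * suc s)) + (27 * d + 27 * d + l * d) ∎))
      where
      open ℕ.≤-Reasoning
      l w : ℕ
      l = 54 * suc s
      w = ∑ elements (∑codeg U)
      expand : ∀ s d → 54 * (s * d) + (27 * d + 27 * d + 54 * suc s * d) ≡ 54 * suc s * (2 * d)
      expand = solve-∀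
      regroup : ∀ l e d w → l * (2 * e + (d + 2 * w)) ≡ l * (2 * e) + l * d + (l * w + l * w)
      regroup = solve-∀
      collect : ∀ s e d m n →
        54 * suc s * (2 * e) + 54 * suc s * d +
          (m * (54 * suc s * n + 54 * suc s * (54 * suc s)) + 27 * d +
            (m * (54 * suc s * n + 54 * suc s * (54 * suc s)) + 27 * d)) ≡
        54 * (2 * e * suc s + 2 * m * n * suc s + 108 * m * (suc s * suc s)) +
          (27 * d + 27 * d + 54 * suc s * d)
      collect = solve-∀

  -- Combines `s*∑deg²≤` with Cauchy-Schwarz, multiplied through by r to avoid fractions. The left
  -- side has m + 1 because the floor condition bounds c n² by m + 1. All error terms go into k²,
  -- which for k of order n² is smaller by a factor of order √n than the main terms.
  9[m+1]²r≤ : ∀ n (U : VertexSubset J[ suc n ,3,⟨1⟩]) (k : ℕ) →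
    let N = suc n; m = size U; e = numInducedEdges U; r = suc (isqrt N) in
    m ≤ k → N * N ≤ k →
    9 * (suc m * suc m) * r ≤ 2 * e * r * N + 2 * m * (N * N) * r + 600 * (k * k)
  9[m+1]²r≤ n U k m≤k N²≤k = begin
    9 * (suc m * suc m) * r
      ≡⟨ expand m s ⟩
    s * (9 * (m * m)) + 9 * (m * m) + 9 * (m + suc m) * r
      ≤⟨ ℕ.+-mono-≤ (ℕ.+-mono-≤ main (ℕ.*-monoʳ-≤ 9 (ℕ.*-mono-≤ m≤k m≤k))) tail ⟩
    (2 * e * r + 2 * m * N * r) * N + 432 * (k * k) + 9 * (k * k) + 108 * (k * k)
      -- 432 + 9 + 108 = 549 is rounded up to 600, which is twice the constant 300 in `error`.
      ≤⟨ ℕ.m≤m+n _ (51 * (k * k)) ⟩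
    (2 * e * r + 2 * m * N * r) * N + 432 * (k * k) + 9 * (k * k) + 108 * (k * k) + 51 * (k * k)
      ≡⟨ collect e r m N (k * k) ⟩
    2 * e * r * N + 2 * m * (N * N) * r + 600 * (k * k) ∎
    where
    open ℕ.≤-Reasoning
    N m e s r d : ℕ
    N = suc n
    m = size U
    e = numInducedEdges U
    s = isqrt N
    r = suc s
    d = ∑deg² U
    N≤N² : N ≤ N * N
    N≤N² = ℕ.m≤m*n N N
    expand : ∀ m s → 9 * (suc m * suc m) * suc s ≡
      s * (9 * (m * m)) + 9 * (m * m) + 9 * (m + suc m) * suc s
    expand = solve-∀
    collect : ∀ e r m N q → (2 * e * r + 2 * m * N * r) * N + 432 * q + 9 * q + 108 * q + 51 * q ≡
      2 * e * r * N + 2 * m * (N * N) * r + 600 * q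
    collect = solve-∀
    main : s * (9 * (m * m)) ≤ (2 * e * r + 2 * m * N * r) * N + 432 * (k * k)
    main = begin
      s * (9 * (m * m))
        ≤⟨ ℕ.*-monoʳ-≤ s (9m²≤n∑deg² U) ⟩
      s * (N * d)
        ≡⟨ assoc s N d ⟩
      s * d * N
        ≤⟨ ℕ.*-monoˡ-≤ N (s*∑deg²≤ U s) ⟩
      (2 * e * r + 2 * m * N * r + 108 * m * (r * r)) * N
        ≤⟨ ℕ.*-monoˡ-≤ N (ℕ.+-monoʳ-≤ (2 * e * r + 2 * m * N * r)
             (ℕ.*-monoʳ-≤ (108 * m) ([1+isqrt]²≤4n n))) ⟩
      (2 * e * r + 2 * m * N * r + 108 * m * (4 * N)) * N
        ≡⟨ distrib (2 * e * r + 2 * m * N * r) m N ⟩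
      (2 * e * r + 2 * m * N * r) * N + 432 * (m * (N * N))
        ≤⟨ ℕ.+-monoʳ-≤ ((2 * e * r + 2 * m * N * r) * N) (ℕ.*-monoʳ-≤ 432 (ℕ.*-mono-≤ m≤k N²≤k)) ⟩
      (2 * e * r + 2 * m * N * r) * N + 432 * (k * k) ∎
      where
      assoc : ∀ s N d → s * (N * d) ≡ s * d * N
      assoc = solve-∀
      distrib : ∀ a m N → (a + 108 * m * (4 * N)) * N ≡ a * N + 432 * (m * (N * N))
      distrib = solve-∀
    tail : 9 * (m + suc m) * r ≤ 108 * (k * k)
    tail = begin
      9 * (m + suc m) * r
        ≤⟨ ℕ.*-mono-≤ (ℕ.*-monoʳ-≤ 9 (ℕ.+-mono-≤ m≤k (ℕ.+-mono-≤ 1≤k m≤k))) r≤4k ⟩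
      9 * (k + (k + k)) * (4 * k)
        ≡⟨ collect′ k ⟩
      108 * (k * k) ∎
      where
      1≤k : 1 ≤ k
      1≤k = ℕ.≤-trans (s≤s z≤n) N²≤k
      r≤4k : r ≤ 4 * k
      r≤4k = ℕ.≤-trans (ℕ.m≤m*n r r) (ℕ.≤-trans ([1+isqrt]²≤4n n)
        (ℕ.*-monoʳ-≤ 4 (ℕ.≤-trans N≤N² N²≤k)))
      collect′ : ∀ k → 9 * (k + (k + k)) * (4 * k) ≡ 108 * (k * k)
      collect′ = solve-∀

open Counting using (isqrt; k²≤n⇒k≤isqrt; 9[m+1]²r≤)

open import Data.Integer.Base using (+_)

-- From natural numbers to rationals.

module Estimate where
  open import Data.Rational.Base using (_+_; _*_; _-_; -_; _≤_; _<_)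

  ι : ℕ → ℚ
  ι n = + n / 1

  -- Since `_/_` normalises by the gcd, facts about it are proved on unnormalised fractions, here
  -- and below, and carried over along `toℚᵘ`.
  ι-mono-≤ : ∀ {m n} → m ℕ.≤ n → ι m ≤ ι n
  ι-mono-≤ {m} {n} m≤n = ℚ.toℚᵘ-cancel-≤
    (ℚᵘ.≤-respʳ-≃ (ℚᵘ.≃-sym (ℚ.toℚᵘ-fromℚᵘ (mkℚᵘ (+ n) 0)))
      (ℚᵘ.≤-respˡ-≃ (ℚᵘ.≃-sym (ℚ.toℚᵘ-fromℚᵘ (mkℚᵘ (+ m) 0)))
        (ℚᵘ.*≤* (ℤ.*-monoʳ-≤-nonNeg (+ 1) (ℤ.+≤+ m≤n)))))

  ι-+ : ∀ m n → ι (m ℕ.+ n) ≡ ι m + ι n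
  ι-+ m n = ℚ.toℚᵘ-injective (begin
    ℚ.toℚᵘ (ι (m ℕ.+ n))           ≈⟨ ℚ.toℚᵘ-fromℚᵘ (mkℚᵘ (+ (m ℕ.+ n)) 0) ⟩
    mkℚᵘ (+ (m ℕ.+ n)) 0           ≈⟨ ℚᵘ.*≡* (trans (cong (ℤ._* + 1) (ℤ.pos-+ m n)) (collect (+ m) (+ n))) ⟩
    mkℚᵘ (+ m) 0 ℚᵘ.+ mkℚᵘ (+ n) 0 ≈⟨ ℚᵘ.+-cong (ℚ.toℚᵘ-fromℚᵘ (mkℚᵘ (+ m) 0)) (ℚ.toℚᵘ-fromℚᵘ (mkℚᵘ (+ n) 0)) ⟨
    ℚ.toℚᵘ (ι m) ℚᵘ.+ ℚ.toℚᵘ (ι n) ≈⟨ ℚ.toℚᵘ-homo-+ (ι m) (ι n) ⟨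
    ℚ.toℚᵘ (ι m + ι n)             ∎)
    where
    open import Relation.Binary.Reasoning.Setoid ℚᵘ.≃-setoid
    collect : ∀ a b → (a ℤ.+ b) ℤ.* + 1 ≡ (a ℤ.* + 1 ℤ.+ b ℤ.* + 1) ℤ.* + 1
    collect = ℤ-Solver.solve-∀

  /-*-/ : ∀ i j d → (i / suc d) * (j / 1) ≡ (i ℤ.* j) / suc d
  /-*-/ i j d = ℚ.toℚᵘ-injective (begin
    ℚ.toℚᵘ ((i / suc d) * (j / 1))           ≈⟨ ℚ.toℚᵘ-homo-* (i / suc d) (j / 1) ⟩
    ℚ.toℚᵘ (i / suc d) ℚᵘ.* ℚ.toℚᵘ (j / 1)   ≈⟨ ℚᵘ.*-cong (ℚ.toℚᵘ-fromℚᵘ (mkℚᵘ i d)) (ℚ.toℚᵘ-fromℚᵘ (mkℚᵘ j 0)) ⟩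
    mkℚᵘ i d ℚᵘ.* mkℚᵘ j 0                   ≈⟨ ℚᵘ.*≡* (cong (λ e → i ℤ.* j ℤ.* + e) (sym (ℕ.*-identityʳ (suc d)))) ⟩
    mkℚᵘ (i ℤ.* j) d                         ≈⟨ ℚ.toℚᵘ-fromℚᵘ (mkℚᵘ (i ℤ.* j) d) ⟨
    ℚ.toℚᵘ ((i ℤ.* j) / suc d)               ∎)
    where open import Relation.Binary.Reasoning.Setoid ℚᵘ.≃-setoid

  ι-* : ∀ m n → ι (m ℕ.* n) ≡ ι m * ι n
  ι-* m n = sym (trans (/-*-/ (+ m) (+ n) 0) (cong (_/ 1) (sym (ℤ.pos-* m n))))

  /-*-ι : ∀ k d → (+ k / suc d) * ι (suc d) ≡ ι k
  /-*-ι k d = trans (/-*-/ (+ k) (+ suc d) d) (ℚ.fromℚᵘ-cong {mkℚᵘ (+ k ℤ.* + suc d) d} {mkℚᵘ (+ k) 0}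
    (ℚᵘ.*≡* (ℤ.*-identityʳ (+ k ℤ.* + suc d))))

  -- The denominator is at least 1, so the absolute value of the numerator suffices.
  ≤-ι : ∀ q → ∃[ k ] q ≤ ι k
  ≤-ι q@(mkℚ i d _) = ℤ.∣ i ∣ , ℚ.toℚᵘ-cancel-≤
    (ℚᵘ.≤-respʳ-≃ (ℚᵘ.≃-sym (ℚ.toℚᵘ-fromℚᵘ (mkℚᵘ (+ ℤ.∣ i ∣) 0))) (ℚᵘ.*≤* (bound i)))
    where
    bound : ∀ i → i ℤ.* + 1 ℤ.≤ + ℤ.∣ i ∣ ℤ.* + suc d
    bound (+ n)    = ℤ.*-monoˡ-≤-nonNeg (+ n) (ℤ.+≤+ (s≤s z≤n))
    bound -[1+ n ] = ℤ.-≤+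

  ι-pos : ∀ n → ℚ.Positive (ι (suc n))
  ι-pos n = ℚ.normalize-pos (suc n) 1

  private
    2ℚ 9ℚ : ℚ
    2ℚ = + 2 / 1
    9ℚ = + 9 / 1

  -- To be read with q a term of the sequence of c, m = |U|, E = e(U), N = n, r ≈ √n and g = −o(n);
  -- η absorbs the slack in the order on ℝ.
  rational-bound : ∀ (q g m N r E η : ℚ) → .{{ℚ.Positive N}} → .{{ℚ.Positive r}} →
    0ℚ ≤ q → q * (N * N) ≤ 1ℚ + m → m ≤ q * (N * N) + η →
    9ℚ * ((1ℚ + m) * (1ℚ + m)) * r ≤
      2ℚ * E * r * N + 2ℚ * m * (N * N) * r + 2ℚ * (g * r) * (N * N * (N * N)) →
    ((+ 9 / 2) * (q * q) - q - g) * (N * (N * N)) ≤ E + η * N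
  rational-bound q g m N r E η 0≤q a≤1+m m≤a+η bound =
    -- After multiplication by 2rN and with a = qN², the main term is 9a²r. It is bounded through a
    -- ≤ 1 + m, then `bound`, then m ≤ a + η; the last costs 2N²rη, which is ηN times 2rN.
    ℚ.*-cancelʳ-≤-pos (2ℚ * (r * N)) {{ℚ.pos*pos⇒pos 2ℚ (r * N)}} (begin
      ((+ 9 / 2) * (q * q) - q - g) * (N * (N * N)) * (2ℚ * (r * N))
        ≡⟨ expand q g N r ⟩
      9ℚ * (a * a) * r - (2ℚ * (N * N) * r * a + G)
        ≤⟨ ℚ.+-monoˡ-≤ (- (2ℚ * (N * N) * r * a + G)) (begin
          9ℚ * (a * a) * r
            ≤⟨ ℚ.*-monoʳ-≤-nonNeg r (ℚ.*-monoˡ-≤-nonNeg 9ℚ (begin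
              a * a                    ≤⟨ ℚ.*-monoʳ-≤-nonNeg a {{a-nonNeg}} a≤1+m ⟩
              (1ℚ + m) * a             ≤⟨ ℚ.*-monoˡ-≤-nonNeg (1ℚ + m)
                                            {{ℚ.nonNegative (ℚ.≤-trans 0≤a a≤1+m)}} a≤1+m ⟩
              (1ℚ + m) * (1ℚ + m)      ∎)) ⟩
          9ℚ * ((1ℚ + m) * (1ℚ + m)) * r
            ≤⟨ bound ⟩
          2ℚ * E * r * N + 2ℚ * m * (N * N) * r + G
            ≡⟨ commute E r N m G ⟩
          2ℚ * E * r * N + 2ℚ * (N * N) * r * m + G
            ≤⟨ ℚ.+-monoˡ-≤ G (ℚ.+-monoʳ-≤ (2ℚ * E * r * N)
                 (ℚ.*-monoˡ-≤-nonNeg (2ℚ * (N * N) * r) m≤a+η)) ⟩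
          2ℚ * E * r * N + 2ℚ * (N * N) * r * (a + η) + G ∎) ⟩
      2ℚ * E * r * N + 2ℚ * (N * N) * r * (a + η) + G - (2ℚ * (N * N) * r * a + G)
        ≡⟨ cancel E r N a η G ⟩
      (E + η * N) * (2ℚ * (r * N)) ∎)
    where
    open ℚ.≤-Reasoning
    open +-*-Solver
    instance
      rN-pos : ℚ.Positive (r * N)
      rN-pos = ℚ.pos*pos⇒pos r N
      NN-pos : ℚ.Positive (N * N)
      NN-pos = ℚ.pos*pos⇒pos N N
      r-nonNeg : ℚ.NonNegative r
      r-nonNeg = ℚ.pos⇒nonNeg r
      2NN-pos : ℚ.Positive (2ℚ * (N * N))
      2NN-pos = ℚ.pos*pos⇒pos 2ℚ (N * N)
      2NNr-nonNeg : ℚ.NonNegative (2ℚ * (N * N) * r)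
      2NNr-nonNeg = ℚ.pos⇒nonNeg (2ℚ * (N * N) * r) {{ℚ.pos*pos⇒pos (2ℚ * (N * N)) r}}
    a G : ℚ
    a = q * (N * N)
    G = 2ℚ * (g * r) * (N * N * (N * N))
    0≤a : 0ℚ ≤ a
    0≤a = ℚ.≤-trans (ℚ.≤-reflexive (sym (ℚ.*-zeroˡ (N * N))))
      (ℚ.*-monoʳ-≤-nonNeg (N * N) {{ℚ.pos⇒nonNeg (N * N)}} 0≤q)
    a-nonNeg : ℚ.NonNegative a
    a-nonNeg = ℚ.nonNegative 0≤a
    expand : ∀ q g N r →
      ((+ 9 / 2) * (q * q) - q - g) * (N * (N * N)) * (2ℚ * (r * N)) ≡
      9ℚ * ((q * (N * N)) * (q * (N * N))) * r -
        (2ℚ * (N * N) * r * (q * (N * N)) + 2ℚ * (g * r) * (N * N * (N * N)))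
    expand = solve 4 (λ q g N r →
      (con (+ 9 / 2) :* (q :* q) :- q :- g) :* (N :* (N :* N)) :* (con 2ℚ :* (r :* N)) :=
      con 9ℚ :* ((q :* (N :* N)) :* (q :* (N :* N))) :* r :-
        (con 2ℚ :* (N :* N) :* r :* (q :* (N :* N)) :+
         con 2ℚ :* (g :* r) :* (N :* N :* (N :* N)))) refl
    commute : ∀ E r N m G → 2ℚ * E * r * N + 2ℚ * m * (N * N) * r + G ≡
                            2ℚ * E * r * N + 2ℚ * (N * N) * r * m + G
    commute = solve 5 (λ E r N m G →
      con 2ℚ :* E :* r :* N :+ con 2ℚ :* m :* (N :* N) :* r :+ G :=
      con 2ℚ :* E :* r :* N :+ con 2ℚ :* (N :* N) :* r :* m :+ G) refl
    cancel : ∀ E r N a η G →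
      2ℚ * E * r * N + 2ℚ * (N * N) * r * (a + η) + G - (2ℚ * (N * N) * r * a + G) ≡
      (E + η * N) * (2ℚ * (r * N))
    cancel = solve 6 (λ E r N a η G →
      con 2ℚ :* E :* r :* N :+ con 2ℚ :* (N :* N) :* r :* (a :+ η) :+ G :-
        (con 2ℚ :* (N :* N) :* r :* a :+ G) :=
      (E :+ η :* N) :* (con 2ℚ :* (r :* N))) refl

  ι-cancel-≤ : ∀ {m n} → ι m ≤ ι n → m ℕ.≤ n
  ι-cancel-≤ {m} {n} ιm≤ιn = ℤ.drop‿+≤+ (ℤ.*-cancelʳ-≤-pos (+ m) (+ n) (+ 1) (ℚᵘ.drop-*≤*
    (ℚᵘ.≤-respʳ-≃ (ℚ.toℚᵘ-fromℚᵘ (mkℚᵘ (+ n) 0))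
      (ℚᵘ.≤-respˡ-≃ (ℚ.toℚᵘ-fromℚᵘ (mkℚᵘ (+ m) 0)) (ℚ.toℚᵘ-mono-≤ ιm≤ιn)))))

  Eventually : (ℕ → Set) → Set
  Eventually P = ∃[ N ] (∀ k → N ℕ.≤ k → P k)

  _and_ : ∀ {P Q} → Eventually P → Eventually Q → Eventually (λ k → P k × Q k)
  (M , p) and (N , q) = M ⊔ N , λ k ≤k →
    p k (ℕ.m⊔n≤o⇒m≤o M N ≤k) , q k (ℕ.m⊔n≤o⇒n≤o M N ≤k)

  -- The error term, of order 1/√n.

  module _ (M : ℕ) where

    -- The numerator comes from the term 600 k² of `9[m+1]²r≤` with k = M n²: that term equals 2
    -- (`error n` · r) n⁴ for r = 1 + `isqrt n`.
    error : ℕ → ℚ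
    error n = + (300 ℕ.* (M ℕ.* M)) / suc (isqrt n)

    error-nonNeg : ∀ n → 0ℚ ≤ error n
    error-nonNeg n = ℚ.nonNegative⁻¹ (error n)
      {{ℚ.normalize-nonNeg (300 ℕ.* (M ℕ.* M)) (suc (isqrt n))}}

    error-small : ∀ δ → 0ℚ < δ → Eventually (λ n → error n ≤ δ)
    -- With C = 300 M², the number k is chosen so that C ≤ δk; from n ≥ k² on, k is at most the
    -- denominator 1 + `isqrt n`.
    error-small δ 0<δ = k ℕ.* k , λ n k²≤n → ℚ.*-cancelʳ-≤-pos (ι (suc (isqrt n))) {{ι-pos (isqrt n)}} (begin
        error n * ι (suc (isqrt n))    ≡⟨ /-*-ι (300 ℕ.* (M ℕ.* M)) (isqrt n) ⟩
        C                              ≡⟨ δC/δ ⟨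
        δ * (ℚ.1/ δ * C)               ≤⟨ ℚ.*-monoˡ-≤-nonNeg δ {{ℚ.pos⇒nonNeg δ}} C/δ≤k ⟩
        δ * ι k                        ≤⟨ ℚ.*-monoˡ-≤-nonNeg δ {{ℚ.pos⇒nonNeg δ}}
                                            (ι-mono-≤ {k} (ℕ.m≤n⇒m≤1+n (k²≤n⇒k≤isqrt {k} k²≤n))) ⟩
        δ * ι (suc (isqrt n))          ∎)
      where
      open ℚ.≤-Reasoning
      instance
        δ-pos : ℚ.Positive δ
        δ-pos = ℚ.positive 0<δ
        δ-nonZero : ℚ.NonZero δ
        δ-nonZero = ℚ.pos⇒nonZero δ
      C : ℚ
      C = ι (300 ℕ.* (M ℕ.* M))
      δC/δ : δ * (ℚ.1/ δ * C) ≡ C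
      δC/δ = trans (sym (ℚ.*-assoc δ (ℚ.1/ δ) C))
        (trans (cong (_* C) (ℚ.*-inverseʳ δ)) (ℚ.*-identityˡ C))
      k : ℕ
      k = proj₁ (≤-ι (ℚ.1/ δ * C))
      C/δ≤k : ℚ.1/ δ * C ≤ ι k
      C/δ≤k = proj₂ (≤-ι (ℚ.1/ δ * C))

    -error→0 : TendsToZero (λ n → fromℚ (- error n))
    -error→0 ε (δ , 0<δ , N , δ≤ε) = N′ , λ n N′≤n →
      -- Strict order on ℝ demands a rational gap. Eventually ε ≥ δ, and `error n` takes only half
      -- of δ; the other half is the gap. The upper bound keeps all of δ because the values are at
      -- most 0.
      (½ * δ , 0<½δ , N , λ k N≤k → lower n (ε-small n N′≤n) (δ≤ε k N≤k)) ,
      (δ , 0<δ , N , λ k N≤k → ℚ.≤-trans (ℚ.+-monoˡ-≤ δ (ℚ.neg-antimono-≤ (error-nonNeg n))) (δ≤ε k N≤k))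
      where
      open ℚ.≤-Reasoning
      0<½δ : 0ℚ < ½ * δ
      0<½δ = subst (_< ½ * δ) (ℚ.*-zeroʳ ½) (ℚ.*-monoʳ-<-pos ½ 0<δ)
      N′ : ℕ
      N′ = proj₁ (error-small (½ * δ) 0<½δ)
      ε-small : ∀ n → N′ ℕ.≤ n → error n ≤ ½ * δ
      ε-small = proj₂ (error-small (½ * δ) 0<½δ)
      lower : ∀ n {x} → error n ≤ ½ * δ → 0ℚ + δ ≤ x → - x + ½ * δ ≤ - error n
      lower n {x} err≤ δ≤x = begin
        - x + ½ * δ              ≤⟨ ℚ.+-monoˡ-≤ (½ * δ) (ℚ.neg-antimono-≤ δ≤x) ⟩
        - (0ℚ + δ) + ½ * δ       ≡⟨ halve δ ⟩
        - (½ * δ)                ≤⟨ ℚ.neg-antimono-≤ err≤ ⟩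
        - error n                ∎
        where
        halve : ∀ δ → - (0ℚ + δ) + ½ * δ ≡ - (½ * δ)
        halve = solve 1 (λ δ → :- (con 0ℚ :+ δ) :+ con ½ :* δ := :- (con ½ :* δ)) refl
          where open +-*-Solver

  -- A Cauchy sequence stays within 1 of some late term. The extra `1ℚ` on the left makes room for
  -- the slack in m ≤ qN² + 1.
  eventually-bounded : ∀ x → ∃[ M ] Eventually (λ k → seq x k + 1ℚ ≤ ι (suc M))
  eventually-bounded x with cauchy x 1ℚ (ℚ.positive⁻¹ 1ℚ)
  ... | N , close with M , b≤M ← ≤-ι (seq x N + 1ℚ + 1ℚ) = M , N , λ k N≤k → begin
    seq x k + 1ℚ                             ≡⟨ split (seq x k) (seq x N) ⟩
    (seq x k - seq x N) + (seq x N + 1ℚ)     ≤⟨ ℚ.+-monoˡ-≤ (seq x N + 1ℚ) (ℚ.≤-trans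
                                                  (p≤∣p∣ (seq x k - seq x N))
                                                  (ℚ.<⇒≤ (close k N N≤k ℕ.≤-refl))) ⟩
    1ℚ + (seq x N + 1ℚ)                      ≡⟨ ℚ.+-comm 1ℚ (seq x N + 1ℚ) ⟩
    seq x N + 1ℚ + 1ℚ                        ≤⟨ b≤M ⟩
    ι M                                      ≤⟨ ι-mono-≤ {M} (ℕ.n≤1+n M) ⟩
    ι (suc M)                                ∎
    where
    open ℚ.≤-Reasoning
    split : ∀ a b → a + 1ℚ ≡ (a - b) + (b + 1ℚ)
    split = solve 2 (λ a b → a :+ con 1ℚ := (a :- b) :+ (b :+ con 1ℚ)) refl
      where open +-*-Solver
    p≤∣p∣ : ∀ p → p ≤ ℚ.∣ p ∣
    p≤∣p∣ p@(mkℚ (+ _) _ _)    = ℚ.≤-refl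
    p≤∣p∣ p@(mkℚ -[1+ _ ] _ _) = ℚ.*≤* ℤ.-≤+

  -- The edge bound at a single rational term q of c.

  module _ (M n : ℕ) (U : VertexSubset J[ suc n ,3,⟨1⟩]) where

    private
      m e r : ℕ
      m = size U
      e = numInducedEdges U
      r = suc (isqrt (suc n))
      N : ℚ
      N = ι (suc n)
      instance
        N-pos : ℚ.Positive N
        N-pos = ι-pos n
        r-pos : ℚ.Positive (ι r)
        r-pos = ι-pos (isqrt (suc n))

    -- The two upper bounds on |U| serve different ends: slack 1 gives m ≤ k with k independent of
    -- η, and slack η enters the final estimate.
    edge-bound : ∀ q η → 0ℚ ≤ q → q + 1ℚ ≤ ι (suc M) →
      q * (N * N) ≤ 1ℚ + ι m → ι m ≤ q * (N * N) + 1ℚ → ι m ≤ q * (N * N) + η →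
      ((+ 9 / 2) * (q * q) - q - error (suc M) (suc n)) * (N * (N * N)) ≤ ι e + η * N
    edge-bound q η 0≤q q≤M a≤1+m m≤a+1 m≤a+η =
      rational-bound q (error (suc M) (suc n)) (ι m) N (ι r) (ι e) η 0≤q a≤1+m m≤a+η
        (subst₂ _≤_ lhs rhs (ι-mono-≤ (9[m+1]²r≤ n U k m≤k n²≤k)))
      where
      n² k C : ℕ
      n² = suc n ℕ.* suc n
      -- Dominates n² because the factor is a successor, and m because qN² + 1 ≤ (q + 1)N².
      k = suc M ℕ.* n²
      C = 300 ℕ.* (suc M ℕ.* suc M)
      n²≤k : n² ℕ.≤ k
      n²≤k = ℕ.m≤m+n n² (M ℕ.* n²)
      1≤NN : 1ℚ ≤ N * N
      1≤NN = subst (1ℚ ≤_) (ι-* (suc n) (suc n)) (ι-mono-≤ {1} {n²} (s≤s z≤n))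
      m≤k : m ℕ.≤ k
      m≤k = ι-cancel-≤ (begin
        ι m                    ≤⟨ m≤a+1 ⟩
        q * (N * N) + 1ℚ       ≤⟨ ℚ.+-monoʳ-≤ (q * (N * N)) 1≤NN ⟩
        q * (N * N) + N * N    ≡⟨ factor q (N * N) ⟩
        (q + 1ℚ) * (N * N)     ≤⟨ ℚ.*-monoʳ-≤-nonNeg (N * N) {{ℚ.pos⇒nonNeg (N * N) {{ℚ.pos*pos⇒pos N N}}}} q≤M ⟩
        ι (suc M) * (N * N)    ≡⟨ cong (ι (suc M) *_) (ι-* (suc n) (suc n)) ⟨
        ι (suc M) * ι n²       ≡⟨ ι-* (suc M) n² ⟨
        ι k                    ∎)
        where
        open ℚ.≤-Reasoning
        factor : ∀ a b → a * b + b ≡ (a + 1ℚ) * b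
        factor = solve 2 (λ a b → a :* b :+ b := (a :+ con 1ℚ) :* b) refl
          where open +-*-Solver
      open ≡-Reasoning
      lhs : ι (9 ℕ.* (suc m ℕ.* suc m) ℕ.* r) ≡ 9ℚ * ((1ℚ + ι m) * (1ℚ + ι m)) * ι r
      lhs = begin
        ι (9 ℕ.* (suc m ℕ.* suc m) ℕ.* r)          ≡⟨ ι-* (9 ℕ.* (suc m ℕ.* suc m)) r ⟩
        ι (9 ℕ.* (suc m ℕ.* suc m)) * ι r          ≡⟨ cong (_* ι r) (ι-* 9 (suc m ℕ.* suc m)) ⟩
        9ℚ * ι (suc m ℕ.* suc m) * ι r             ≡⟨ cong (λ p → 9ℚ * p * ι r) (ι-* (suc m) (suc m)) ⟩
        9ℚ * (ι (suc m) * ι (suc m)) * ι r         ≡⟨ cong (λ p → 9ℚ * (p * p) * ι r) (ι-+ 1 m) ⟩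
        9ℚ * ((1ℚ + ι m) * (1ℚ + ι m)) * ι r       ∎
      NN : ι n² ≡ N * N
      NN = ι-* (suc n) (suc n)
      edges : ι (2 ℕ.* e ℕ.* r ℕ.* suc n) ≡ 2ℚ * ι e * ι r * N
      edges = trans (ι-* (2 ℕ.* e ℕ.* r) (suc n))
        (cong (_* N) (trans (ι-* (2 ℕ.* e) r) (cong (_* ι r) (ι-* 2 e))))
      size-term : ι (2 ℕ.* m ℕ.* n² ℕ.* r) ≡ 2ℚ * ι m * (N * N) * ι r
      size-term = trans (ι-* (2 ℕ.* m ℕ.* n²) r)
        (cong (_* ι r) (trans (ι-* (2 ℕ.* m) n²) (cong₂ _*_ (ι-* 2 m) NN)))
      error-term : ι (600 ℕ.* (k ℕ.* k)) ≡
        2ℚ * (error (suc M) (suc n) * ι r) * (N * N * (N * N))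
      error-term = begin
        ι (600 ℕ.* (k ℕ.* k))
          ≡⟨ cong ι (regroup (suc M) n²) ⟩
        ι (2 ℕ.* C ℕ.* (n² ℕ.* n²))
          ≡⟨ ι-* (2 ℕ.* C) (n² ℕ.* n²) ⟩
        ι (2 ℕ.* C) * ι (n² ℕ.* n²)
          ≡⟨ cong₂ _*_ (ι-* 2 C) (ι-* n² n²) ⟩
        2ℚ * ι C * (ι n² * ι n²)
          ≡⟨ cong₂ (λ a b → 2ℚ * a * (b * b)) (sym (/-*-ι C (isqrt (suc n)))) NN ⟩
        2ℚ * (error (suc M) (suc n) * ι r) * (N * N * (N * N)) ∎
        where
        regroup : ∀ a b → 600 ℕ.* ((a ℕ.* b) ℕ.* (a ℕ.* b)) ≡ 2 ℕ.* (300 ℕ.* (a ℕ.* a)) ℕ.* (b ℕ.* b)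
        regroup = ℕ-Solver.solve-∀
      rhs : ι (2 ℕ.* e ℕ.* r ℕ.* suc n ℕ.+ 2 ℕ.* m ℕ.* n² ℕ.* r ℕ.+ 600 ℕ.* (k ℕ.* k)) ≡
        2ℚ * ι e * ι r * N + 2ℚ * ι m * (N * N) * ι r +
          2ℚ * (error (suc M) (suc n) * ι r) * (N * N * (N * N))
      rhs = trans (ι-+ (2 ℕ.* e ℕ.* r ℕ.* suc n ℕ.+ 2 ℕ.* m ℕ.* n² ℕ.* r) (600 ℕ.* (k ℕ.* k)))
        (cong₂ _+_ (trans (ι-+ (2 ℕ.* e ℕ.* r ℕ.* suc n) (2 ℕ.* m ℕ.* n² ℕ.* r))
                          (cong₂ _+_ edges size-term)) error-term)

  -- From rational terms to real numbers.

  module _ (c : ℝ) (2/9<c : fromℚ (+ 2 / 9) Defs.< c) where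

    private
      M : ℕ
      M = proj₁ (eventually-bounded c)

      c≤M : Eventually (λ k → seq c k + 1ℚ ≤ ι (suc M))
      c≤M = proj₂ (eventually-bounded c)

      δ : ℚ
      δ = proj₁ 2/9<c

      0<δ : 0ℚ < δ
      0<δ = proj₁ (proj₂ 2/9<c)

    -- Built from n and the integer bound `M` on the sequence of c, hence independent of U. It is
    -- the loss in the estimate, so its values are at most 0.
    o : ℕ → ℝ
    o n = fromℚ (- error (suc M) n)

    o→0 : TendsToZero o
    o→0 = -error→0 (suc M)

    edges-≥ : ∀ n (U : VertexSubset J[ n ,3,⟨1⟩]) → (size U) IsFloorOf (c Defs.* fromℕ (n ^ 2)) →
      (fromℚ (+ 9 / 2) Defs.* (c Defs.* c) Defs.- c Defs.+ o n) Defs.* fromℕ (n ^ 3)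
        Defs.≤ fromℕ (numInducedEdges U)
    -- N = 0 cannot be cancelled, but the factor n³ makes the left side 0.
    edges-≥ zero U _ ε 0<ε = 0 , λ k _ → begin
      ((+ 9 / 2) * (seq c k * seq c k) - seq c k - error (suc M) 0) * 0ℚ
        ≡⟨ ℚ.*-zeroʳ ((+ 9 / 2) * (seq c k * seq c k) - seq c k - error (suc M) 0) ⟩
      0ℚ + 0ℚ
        ≤⟨ ℚ.+-mono-≤ (ι-mono-≤ {0} {numInducedEdges U} z≤n) (ℚ.<⇒≤ 0<ε) ⟩
      ι (numInducedEdges U) + ε ∎
      where open ℚ.≤-Reasoning
    edges-≥ (suc n) U (m≤cn² , (δ′ , 0<δ′ , cn²<m+1)) ε 0<ε =
      -- From index K on, the five hypotheses on terms of c hold together, and a rational inequality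
      -- at each index remains.
      let K , eventually = (proj₂ (proj₂ 2/9<c) and c≤M) and (cn²<m+1 and (m≤cn² 1ℚ (ℚ.positive⁻¹ 1ℚ) and m≤cn² η 0<η))
      in K , λ k K≤k → at {seq c k} n²≡ n³≡ (eventually k K≤k)
      where
      N η : ℚ
      N = ι (suc n)
      -- Chosen so that the slack ηN left by `edge-bound` is exactly ε.
      η = ε * (+ 1 / suc n)
      0<η : 0ℚ < η
      0<η = ℚ.positive⁻¹ η {{ℚ.pos*pos⇒pos ε {{ℚ.positive 0<ε}} (+ 1 / suc n)
                                {{ℚ.normalize-pos 1 (suc n)}}}}
      ηN≡ε : η * N ≡ ε
      ηN≡ε = trans (ℚ.*-assoc ε (+ 1 / suc n) N)
        (trans (cong (ε *_) (/-*-ι 1 n)) (ℚ.*-identityʳ ε))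
      n²≡ : ι (suc n ^ 2) ≡ N * N
      n²≡ = trans (ι-* (suc n) (suc n ^ 1))
        (cong (λ k → N * ι k) (ℕ.*-identityʳ (suc n)))
      n³≡ : ι (suc n ^ 3) ≡ N * (N * N)
      n³≡ = trans (ι-* (suc n) (suc n ^ 2)) (cong (N *_) n²≡)
      -- The powers are abstracted into variables so that matching on `refl` replaces them by
      -- products of N.
      at : ∀ {q N² N³} → N² ≡ N * N → N³ ≡ N * (N * N) →
        ((+ 2 / 9) + δ ≤ q × q + 1ℚ ≤ ι (suc M)) ×
        (q * N² + δ′ ≤ ι (suc (size U)) × (ι (size U) ≤ q * N² + 1ℚ × ι (size U) ≤ q * N² + η)) →
        ((+ 9 / 2) * (q * q) - q - error (suc M) (suc n)) * N³ ≤ ι (numInducedEdges U) + ε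
      at {q} refl refl ((2/9≤q , q≤M) , a≤m+1 , m≤a+1 , m≤a+η) =
        subst (λ x → ((+ 9 / 2) * (q * q) - q - error (suc M) (suc n)) * (N * (N * N)) ≤
                     ι (numInducedEdges U) + x) ηN≡ε
          (edge-bound M n U q η 0≤q q≤M
            (ℚ.≤-trans (p≤p+q 0<δ′) (ℚ.≤-trans a≤m+1 (ℚ.≤-reflexive (ι-+ 1 (size U)))))
            m≤a+1 m≤a+η)
        where
        p≤p+q : ∀ {p q} → 0ℚ < q → p ≤ p + q
        p≤p+q {p} 0<q =
          ℚ.≤-trans (ℚ.≤-reflexive (sym (ℚ.+-identityʳ p))) (ℚ.+-monoʳ-≤ p (ℚ.<⇒≤ 0<q))
        -- Squaring qN² ≤ 1 + m requires q ≥ 0, which c > 2/9 supplies at these indices.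
        0≤q : 0ℚ ≤ q
        0≤q = ℚ.≤-trans (ℚ.<⇒≤ (ℚ.positive⁻¹ (+ 2 / 9))) (ℚ.≤-trans (p≤p+q 0<δ) 2/9≤q)

open Defs using (_+_; _*_; _-_; _<_; _≤_)

theorem3 : (c : ℝ) → fromℚ (+ 2 / 9) < c →
    ∃[ o ] TendsToZero o ×
    ((n : ℕ) (U : VertexSubset J[ n ,3,⟨1⟩]) →
    (size U) IsFloorOf (c * fromℕ (n ^ 2)) →
    (fromℚ (+ 9 / 2) * (c * c) - c + o n) * fromℕ (n ^ 3)
    ≤ fromℕ (numInducedEdges U))
theorem3 c 2/9<c = o c 2/9<c , o→0 c 2/9<c , edges-≥ c 2/9<c
  where open Estimate
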